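{- Let $w$ be a permutation that avoids the pattern $1423$ (i.e. $p_{1423}(w)=0$). Then $c_w(\beta)\in\mathbb{Z}_{\geq 0}[\beta]$, that is, every coefficient of the polynomial $c_w(\beta)$ is a nonnegative integer.
   Context: For $n\ge 0$, $S_n$ is the set of permutations of $\{1,\dots,n\}$, written in one-line notation $w=w(1)\cdots w(n)$; $S_0=\{\emptyset\}$. A word is a finite sequence of distinct positive integers; $|u|$ denotes its length. A subword of a word $v=v(1)\cdots v(n)$ is a word $v(i_1)\cdots v(i_m)$ with $1\le i_1<\cdots<i_m\le n$ (including the empty word $\emptyset$); write $u\le v$ if $u$ is a subword of $v$. For a word $u$, $\mathrm{perm}(u)$ is the permutation whose entries are in the same relative order as $u$ (e.g. $\mathrm{perm}(2574)=1342$), and $\mathrm{perm}(\emptyset)=\emptyset$. For $w\in S_n$ and $u\in S_m$, $p_u(w)$ is the number of index sequences $i_1<\cdots<i_m$ with $\mathrm{perm}(w(i_1)\cdots w(i_m))=u$, and $w$ avoids $u$ if $p_u(w)=0$. For $w\in S_n$ the $\beta$-Grothendieck polynomial $\mathfrak{G}^{(\beta)}_w(x)\in\mathbb{Z}[\beta][x_1,\dots,x_n]$ is defined by $\mathfrak{G}^{(\beta)}_{w_0}=x_1^{n-1}x_2^{n-2}\cdots x_{n-1}$ for $w_0=n\cdots 21$, and $\mathfrak{G}^{(\beta)}_w=\pi_i\,\mathfrak{G}^{(\beta)}_{ws_i}$ whenever $w(i)<w(i+1)$, where $ws_i$ is $w$ with the entries in positions $i,i+1$ swapped, $\pi_i f=\partial_i\big((1+\beta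 x_{i+1})f\big)$, and $\partial_i f=\frac{f-s_i f}{x_i-x_{i+1}}$ with $s_i f$ the polynomial $f$ with $x_i,x_{i+1}$ interchanged (this is independent of the choice of $i$). Its principal specialization is $\Upsilon_w(\beta)=\mathfrak{G}^{(\beta)}_w(1,\dots,1)\in\mathbb{Z}[\beta]$, with $\Upsilon_\emptyset(\beta)=1$. Define $c_w(\beta)=\sum_{\emptyset\le v\le w}(-1)^{|w|-|v|}\Upsilon_{\mathrm{perm}(v)}(\beta)$, where the sum is over all subwords $v$ of $w$ (equivalently over all subsets of positions of $w$). Equivalently, $c_\emptyset(\beta)=1$ and $c_w(\beta)=\Upsilon_w(\beta)-\sum_{v\in S_m,\,0\le m<n}c_v(\beta)\,p_v(w)$ for $w\in S_n$, $n\ge1$. -}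

module Defs where

open import Data.Nat as ℕ using (ℕ; zero; suc; _<ᵇ_; _∸_; _+_; _*_)
open import Data.Integer as ℤ using (ℤ; +_)
open import Data.List using (List; []; _∷_; _++_; map; length; upTo; downFrom; concatMap; filter; foldr)
open import Data.List.Properties using (≡-dec)
open import Data.List.Relation.Binary.Permutation.Propositional using (_↭_)
open import Data.Bool using (Bool; true; false; if_then_else_)
open import Data.Maybe as Maybe using (Maybe; just; nothing)

IsPerm : List ℕ → Set
IsPerm w = w ↭ map suc (upTo (length w))

subwords : List ℕ → List (List ℕ)
subwords [] = [] ∷ []
subwords (a ∷ r) = map (a ∷_) (subwords r) ++ subwords r

countLess : ℕ → List ℕ → ℕ
countLess a [] = 0
countLess a (b ∷ r) = (if b <ᵇ a then 1 else 0) + countLess a r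

stdz : List ℕ → List ℕ
stdz v = map (λ a → suc (countLess a v)) v

patternCount : List ℕ → List ℕ → ℕ
patternCount u w = length (filter (λ v → ≡-dec ℕ._≟_ (stdz v) u) (subwords w))

-- Polynomials in x_1..x_n with coefficients in ℤ[β], as (unnormalised)
-- lists of terms  coef · β^bdeg · x^exps.

record Term : Set where
  constructor mkTerm
  field
    exps : List ℕ
    bdeg : ℕ
    coef : ℤ

Poly : Set
Poly = List Term

get : List ℕ → ℕ → ℕ
get [] _ = 0
get (a ∷ _) zero = a
get (_ ∷ r) (suc i) = get r i

set : List ℕ → ℕ → ℕ → List ℕ
set [] _ _ = []
set (_ ∷ r) zero v = v ∷ r
set (a ∷ r) (suc i) v = a ∷ set r i v

-- divided difference ∂ (positions i, i+1, 0-based) applied to one monomial: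
-- (x^p y^q - x^q y^p)/(x - y)
ddTerm : ℕ → Term → Poly
ddTerm i (mkTerm xs b c) =
  let p = get xs i ; q = get xs (suc i) in
  if q <ᵇ p
  then map (λ k → mkTerm (set (set xs i (p ∸ 1 ∸ k)) (suc i) (q + k)) b c) (upTo (p ∸ q))
  else (if p <ᵇ q
        then map (λ k → mkTerm (set (set xs i (q ∸ 1 ∸ k)) (suc i) (p + k)) b (ℤ.- c)) (upTo (q ∸ p))
        else [])

divDiff : ℕ → Poly → Poly
divDiff i f = concatMap (ddTerm i) f

mulOneBeta : ℕ → Poly → Poly
mulOneBeta i f = concatMap (λ { (mkTerm xs b c) →
  mkTerm xs b c ∷ mkTerm (set xs (suc i) (suc (get xs (suc i)))) (suc b) c ∷ [] }) f

piOp : ℕ → Poly → Poly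
piOp i f = divDiff i (mulOneBeta i f)

-- β-Grothendieck polynomials.  G_{w0} = x_1^{n-1} ⋯ x_{n-1};
-- G_w = π_i G_{w s_i} for the first ascent i of w (choice irrelevant).

firstAscent : List ℕ → Maybe ℕ
firstAscent (a ∷ b ∷ r) = if a <ᵇ b then just 0 else Maybe.map suc (firstAscent (b ∷ r))
firstAscent _ = nothing

swapAt : ℕ → List ℕ → List ℕ
swapAt zero (a ∷ b ∷ r) = b ∷ a ∷ r
swapAt (suc i) (a ∷ r) = a ∷ swapAt i r
swapAt _ xs = xs

grothFuel : ℕ → List ℕ → Poly
grothFuel fuel w with firstAscent w
grothFuel fuel w | nothing = mkTerm (downFrom (length w)) 0 (+ 1) ∷ []
grothFuel zero w | just i = []
grothFuel (suc f) w | just i = piOp i (grothFuel f (swapAt i w))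

-- fuel n*n exceeds the number n(n-1)/2 of steps needed from w0
groth : List ℕ → Poly
groth w = grothFuel (length w * length w) w

sumℤ : List ℤ → ℤ
sumℤ = foldr ℤ._+_ (+ 0)

coeffAtOnes : Poly → ℕ → ℤ
coeffAtOnes f k = sumℤ (map (λ { (mkTerm _ b c) → if b ℕ.≡ᵇ k then c else + 0 }) f)

upsilonCoeff : List ℕ → ℕ → ℤ
upsilonCoeff w k = coeffAtOnes (groth w) k

signPow : ℕ → ℤ
signPow zero = + 1
signPow (suc m) = ℤ.- signPow m

cCoeff : List ℕ → ℕ → ℤ
cCoeff w k = sumℤ (map (λ v → signPow (length w ∸ length v) ℤ.* upsilonCoeff (stdz v) k) (subwords w))

{-# OPTIONS --safe #-}

-- Write w = A 1 B.  Removing the first column of the pipe dreams of w expresses 𝔊_w as a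
-- sum, with positive weights, of polynomials 𝔊_{AW}.  At x = 1 the words W arise by cutting
-- B into consecutive blocks, each ending with its minimum, and rotating that minimum to the
-- front of its block, together with a choice of some descents between consecutive minima,
-- each weighted by β.  If B avoids 312, a letter can be inserted into a cut of a subword of B
-- in a canonical way, and W determines the letters that cannot be so inserted (the ends of
-- the nontrivial blocks and of the chosen descents).  Freezing these letters, c_w becomes a
-- nonnegative combination of alternating sums over the subwords of A W that contain the
-- frozen letters.  A W may contain 1423 again, but the smaller letter of each pair reversed
-- by a rotation is frozen, so the condition "each 1423 pattern has its 2 frozen" is
-- inherited; it is all that the insertion argument needs, and induction applies.

module Submission where

open import Defs
open import Algebra.Properties.AbelianGroup using (∙-cancelˡ)
open import Data.Bool using (Bool; true; false; if_then_else_; T)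
open import Data.Empty using (⊥; ⊥-elim)
open import Data.Integer
  using (ℤ; +_; _≤_; +≤+; _+_; _*_; _-_; -_; _^_; ∣_∣; ≢-nonZero)
import Data.Integer.Properties as ℤₚ
open import Data.Integer.Tactic.RingSolver using (solve-∀)
open import Data.List
  using (List; []; _∷_; _++_; map; length; upTo; downFrom; applyUpTo; concatMap; filter)
open import Data.List.Properties
  using (map-upTo; map-++; length-map; length-++; length-downFrom; ++-assoc; ++-identityʳ; ∷-injectiveʳ; ≡-dec)
open import Data.List.Membership.Propositional using (_∈_)
open import Data.List.Membership.Propositional.Properties using (∈-filter⁺; ∈-++⁺ˡ; ∈-++⁺ʳ; ∈-map⁺)
open import Data.List.Relation.Binary.Permutation.Propositional
  using (_↭_; prep; swap; ↭-refl; ↭-trans; ↭-sym; ↭-reflexive; ↭⇒↭ₛ)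
open import Data.List.Relation.Binary.Permutation.Propositional.Properties
  using (↭-length; ↭-empty-inv; All-resp-↭; ∈-resp-↭; shift; ++⁺ˡ)
import Data.List.Relation.Binary.Permutation.Setoid.Properties as ↭ₛ
open import Data.List.Relation.Unary.All as All using (All; []; _∷_)
import Data.List.Relation.Unary.All.Properties as Allₚ
open import Data.List.Relation.Unary.AllPairs as AllPairs using ([]; _∷_)
open import Data.List.Relation.Unary.Any as Any using (Any; here; there)
open import Data.List.Relation.Unary.Unique.Propositional using (Unique)
import Data.List.Relation.Unary.Unique.Propositional.Properties as Uniqueₚ
open import Data.Maybe as Maybe using (Maybe; just; nothing)
open import Data.Nat as ℕ using (ℕ; zero; suc; s≤s; z≤n; _<ᵇ_; _∸_)
import Data.Nat.Properties as ℕₚ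
open import Data.Product using (_×_; _,_; proj₁; Σ)
open import Data.Sum using (_⊎_; inj₁; inj₂)
open import Data.Unit using (tt)
open import Function using (_∘_; id)
open import Relation.Binary.Definitions using (tri<; tri≈; tri>)
open import Relation.Binary.PropositionalEquality
  using (_≡_; _≢_; refl; sym; trans; cong; cong₂; subst; subst₂; setoid; module ≡-Reasoning)
open import Relation.Nullary using (yes; no)

-- Pipe dreams serve only as motivation. The column expansion is taken as a definition; it is shown
-- to satisfy `f = π_i f′` at every ascent and to give the staircase monomial on descending words,
-- and this determines it. The divided difference is multiplied out to avoid division, so the
-- relation says nothing where `x i = x (suc i)`, in particular not at the point (1, 1, ...) that
-- matters. The identity is therefore proved at points with distinct coordinates and then carried
-- over to (1, 1, ...) by congruences.
--
-- Freezing is forced by how cancellation works. A free letter `b` enters as "words with `b` minus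
-- words without `b`". Outcomes in which `b` is a bystander pair off with the outcomes of the word
-- without `b`, which gives the same kind of difference again, with `b` still free. Outcomes in
-- which `b` took part in a move or in a chosen descent have no partner: they survive with a plus
-- sign, and from then on `b` must be present in every word. So even an entirely free word leads to
-- words with frozen letters, and the induction has to be about marked words.

<ᵇ-true : ∀ {m n} → m ℕ.< n → (m <ᵇ n) ≡ true
<ᵇ-true {m} {n} lt with m <ᵇ n | ℕₚ.<⇒<ᵇ lt
... | true | _ = refl

<ᵇ-false : ∀ {m n} → n ℕ.≤ m → (m <ᵇ n) ≡ false
<ᵇ-false {m} {n} ge with m <ᵇ n in eq
... | true  = ⊥-elim (ℕₚ.≤⇒≯ ge (ℕₚ.<ᵇ⇒< m n (subst T (sym eq) tt)))
... | false = refl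

<ᵇ-true⁻¹ : ∀ {m n} → (m <ᵇ n) ≡ true → m ℕ.< n
<ᵇ-true⁻¹ {m} {n} eq = ℕₚ.<ᵇ⇒< m n (subst T (sym eq) tt)

<ᵇ-false⁻¹ : ∀ {m n} → (m <ᵇ n) ≡ false → n ℕ.≤ m
<ᵇ-false⁻¹ eq = ℕₚ.≮⇒≥ (λ m<n → subst T eq (ℕₚ.<⇒<ᵇ m<n))

-- Evaluation of polynomials and the operators π_i

Env : Set
Env = ℕ → ℤ

-- A polynomial in β is handled through its pairings with all linear
-- functionals on ℤ[β], a functional being given by its values on the powers of β.
-- Multiplication by β is then precomposition with S.
Functional : Set
Functional = ℕ → ℤ

Val : Set
Val = Functional → ℤ

S : Functional → Functional
S μ d = μ (suc d)

one : Env
one _ = + 1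

monomial : List ℕ → Env → ℤ
monomial []       x = + 1
monomial (e ∷ es) x = x 0 ^ e * monomial es (x ∘ suc)

evalTerm : Term → Env → Val
evalTerm (mkTerm es b c) x μ = c * (monomial es x * μ b)

eval : Poly → Env → Val
eval []      x μ = + 0
eval (t ∷ f) x μ = evalTerm t x μ + eval f x μ

eval-++ : ∀ f h x μ → eval (f ++ h) x μ ≡ eval f x μ + eval h x μ
eval-++ []      h x μ = sym (ℤₚ.+-identityˡ _)
eval-++ (t ∷ f) h x μ = trans (cong (λ s → evalTerm t x μ + s) (eval-++ f h x μ)) (sym (ℤₚ.+-assoc (evalTerm t x μ) _ _))

swapEnv : {A : Set} → ℕ → (ℕ → A) → (ℕ → A)
swapEnv zero    x zero          = x 1
swapEnv zero    x (suc zero)    = x 0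
swapEnv zero    x (suc (suc j)) = x (suc (suc j))
swapEnv (suc i) x zero          = x 0
swapEnv (suc i) x (suc j)       = swapEnv i (x ∘ suc) j

swapEnv-left : ∀ i (x : Env) → swapEnv i x i ≡ x (suc i)
swapEnv-left zero    x = refl
swapEnv-left (suc i) x = swapEnv-left i (x ∘ suc)

swapEnv-right : ∀ i (x : Env) → swapEnv i x (suc i) ≡ x i
swapEnv-right zero    x = refl
swapEnv-right (suc i) x = swapEnv-right i (x ∘ suc)

swapEnv-< : ∀ i (x : Env) j → j ℕ.< i → swapEnv i x j ≡ x j
swapEnv-< (suc i) x zero    _         = refl
swapEnv-< (suc i) x (suc j) (s≤s j<i) = swapEnv-< i (x ∘ suc) j j<i

swapEnv-> : ∀ i (x : Env) j → suc i ℕ.< j → swapEnv i x j ≡ x j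
swapEnv-> zero    x (suc zero)    (s≤s ())
swapEnv-> zero    x (suc (suc j)) _         = refl
swapEnv-> (suc i) x (suc j)       (s≤s i<j) = swapEnv-> i (x ∘ suc) j i<j

swapEnv-involutive : ∀ {A : Set} i (x : ℕ → A) j → swapEnv i (swapEnv i x) j ≡ x j
swapEnv-involutive zero    x zero          = refl
swapEnv-involutive zero    x (suc zero)    = refl
swapEnv-involutive zero    x (suc (suc j)) = refl
swapEnv-involutive (suc i) x zero          = refl
swapEnv-involutive (suc i) x (suc j)       = swapEnv-involutive i (x ∘ suc) j

swapEnv-map : ∀ {A B : Set} i (h : A → B) (x : ℕ → A) j → swapEnv i (h ∘ x) j ≡ h (swapEnv i x j)
swapEnv-map zero    h x zero          = refl
swapEnv-map zero    h x (suc zero)    = refl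
swapEnv-map zero    h x (suc (suc j)) = refl
swapEnv-map (suc i) h x zero          = refl
swapEnv-map (suc i) h x (suc j)       = swapEnv-map i h (x ∘ suc) j

Distinct : Env → Set
Distinct x = ∀ j k → x j ≡ x k → j ≡ k

-- `swapEnv i x` is `x ∘ σ` for the transposition `σ = swapEnv i id`, which is its own inverse and
-- hence injective.
Distinct-swapEnv : ∀ i x → Distinct x → Distinct (swapEnv i x)
Distinct-swapEnv i x d j k e = trans (sym (back j)) (trans (cong (swapEnv i id)
  (d _ _ (trans (sym (swapEnv-map i x id j)) (trans e (swapEnv-map i x id k))))) (back k))
  where
  back : ∀ j → swapEnv i id (swapEnv i id j) ≡ j
  back j = trans (sym (swapEnv-map i (swapEnv i id) id j)) (swapEnv-involutive i id j)

-- The factor of a monomial that does not involve the variables i and i + 1.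
rest : ℕ → List ℕ → Env → ℤ
rest zero    (_ ∷ _ ∷ r) x = monomial r (x ∘ suc ∘ suc)
rest (suc i) (e ∷ es)    x = x 0 ^ e * rest i es (x ∘ suc)
rest _       _           x = + 1

rest-swapEnv : ∀ i es x → rest i es (swapEnv i x) ≡ rest i es x
rest-swapEnv zero    []          x = refl
rest-swapEnv zero    (_ ∷ [])    x = refl
rest-swapEnv zero    (_ ∷ _ ∷ _) x = refl
rest-swapEnv (suc i) []          x = refl
rest-swapEnv (suc i) (e ∷ es)    x = cong (x 0 ^ e *_) (rest-swapEnv i es (x ∘ suc))

private
  to-front : ∀ h a r → h * (a * r) ≡ a * (h * r)
  to-front = solve-∀

monomial-split : ∀ i es x → suc i ℕ.< length es →
  monomial es x ≡ (x i ^ get es i * x (suc i) ^ get es (suc i)) * rest i es x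
monomial-split zero    (p ∷ q ∷ r) x _       = sym (ℤₚ.*-assoc (x 0 ^ p) _ _)
monomial-split zero    (p ∷ [])    x (s≤s ())
monomial-split (suc i) (e ∷ es)    x (s≤s l) =
  trans (cong (x 0 ^ e *_) (monomial-split i es (x ∘ suc) l))
        (to-front (x 0 ^ e) (x (suc i) ^ get es i * x (suc (suc i)) ^ get es (suc i)) _)

monomial-set₂ : ∀ i es x p q → suc i ℕ.< length es →
  monomial (set (set es i p) (suc i) q) x ≡ (x i ^ p * x (suc i) ^ q) * rest i es x
monomial-set₂ zero    (_ ∷ _ ∷ r) x p q _       = sym (ℤₚ.*-assoc (x 0 ^ p) _ _)
monomial-set₂ zero    (_ ∷ [])    x p q (s≤s ())
monomial-set₂ (suc i) (e ∷ es)    x p q (s≤s l) =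
  trans (cong (x 0 ^ e *_) (monomial-set₂ i es (x ∘ suc) p q l))
        (to-front (x 0 ^ e) (x (suc i) ^ p * x (suc (suc i)) ^ q) _)

monomial-set₁ : ∀ i es x → suc i ℕ.< length es →
  monomial (set es (suc i) (suc (get es (suc i)))) x ≡ x (suc i) * monomial es x
monomial-set₁ zero (p ∷ q ∷ r) x _ = lem (x 0 ^ p) (x 1) (x 1 ^ q) _
  where
  lem : ∀ a y b m → a * ((y * b) * m) ≡ y * (a * (b * m))
  lem = solve-∀
monomial-set₁ zero    (p ∷ []) x (s≤s ())
monomial-set₁ (suc i) (e ∷ es) x (s≤s l) =
  trans (cong (x 0 ^ e *_) (monomial-set₁ i es (x ∘ suc) l)) (to-front (x 0 ^ e) (x (suc (suc i))) _)

sumTo : ℕ → (ℕ → ℤ) → ℤ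
sumTo zero    t = + 0
sumTo (suc n) t = t 0 + sumTo n (t ∘ suc)

sumTo-cong : ∀ n {s t : ℕ → ℤ} → (∀ k → s k ≡ t k) → sumTo n s ≡ sumTo n t
sumTo-cong zero    e = refl
sumTo-cong (suc n) e = cong₂ _+_ (e 0) (sumTo-cong n (e ∘ suc))

-- Used only with `a = b`, but peeling off the first summand raises `b` alone, so the induction
-- needs the two exponents to be independent.
geometric : ∀ X Y d a b →
  (X - Y) * sumTo d (λ k → X ^ ((a ℕ.+ d) ∸ 1 ∸ k) * Y ^ (b ℕ.+ k))
    ≡ X ^ (a ℕ.+ d) * Y ^ b - X ^ a * Y ^ (b ℕ.+ d)
geometric X Y zero a b = begin
  (X - Y) * + 0                                           ≡⟨ ℤₚ.*-zeroʳ (X - Y) ⟩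
  + 0                                                     ≡⟨ ℤₚ.+-inverseʳ (X ^ a * Y ^ b) ⟨
  X ^ a * Y ^ b - X ^ a * Y ^ b
    ≡⟨ cong₂ (λ m n → X ^ m * Y ^ b - X ^ a * Y ^ n) (ℕₚ.+-identityʳ a) (ℕₚ.+-identityʳ b) ⟨
  X ^ (a ℕ.+ 0) * Y ^ b - X ^ a * Y ^ (b ℕ.+ 0)           ∎
  where open ≡-Reasoning
geometric X Y (suc d) a b rewrite ℕₚ.+-suc a d | ℕₚ.+-identityʳ b = begin
  (X - Y) * (X ^ (a ℕ.+ d) * Y ^ b + sumTo d (λ k → X ^ (a ℕ.+ d ∸ suc k) * Y ^ (b ℕ.+ suc k)))
    ≡⟨ cong (λ s → (X - Y) * (X ^ (a ℕ.+ d) * Y ^ b + s)) (sumTo-cong d (λ k →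
         cong₂ (λ m n → X ^ m * Y ^ n) (sym (ℕₚ.∸-+-assoc (a ℕ.+ d) 1 k)) (ℕₚ.+-suc b k))) ⟩
  (X - Y) * (X ^ (a ℕ.+ d) * Y ^ b + sumTo d (λ k → X ^ (a ℕ.+ d ∸ 1 ∸ k) * Y ^ (suc b ℕ.+ k)))
    ≡⟨ ℤₚ.*-distribˡ-+ (X - Y) _ _ ⟩
  (X - Y) * (X ^ (a ℕ.+ d) * Y ^ b) + (X - Y) * sumTo d (λ k → X ^ (a ℕ.+ d ∸ 1 ∸ k) * Y ^ (suc b ℕ.+ k))
    ≡⟨ cong (λ s → (X - Y) * (X ^ (a ℕ.+ d) * Y ^ b) + s) (geometric X Y d a (suc b)) ⟩
  (X - Y) * (X ^ (a ℕ.+ d) * Y ^ b) + (X ^ (a ℕ.+ d) * (Y * Y ^ b) - X ^ a * (Y * Y ^ (b ℕ.+ d)))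
    ≡⟨ telescope X Y (X ^ (a ℕ.+ d)) (Y ^ b) (X ^ a) (Y ^ (b ℕ.+ d)) ⟩
  X * X ^ (a ℕ.+ d) * Y ^ b - X ^ a * (Y * Y ^ (b ℕ.+ d))
    ≡⟨ cong (λ n → X * X ^ (a ℕ.+ d) * Y ^ b - X ^ a * Y ^ n) (ℕₚ.+-suc b d) ⟨
  X * X ^ (a ℕ.+ d) * Y ^ b - X ^ a * Y ^ (b ℕ.+ suc d) ∎
  where
  open ≡-Reasoning
  telescope : ∀ X Y P Q R T → (X - Y) * (P * Q) + (P * (Y * Q) - R * (Y * T)) ≡ X * P * Q - R * (Y * T)
  telescope = solve-∀

eval-applyUpTo : ∀ n (h : ℕ → Term) x μ C (t : ℕ → ℤ) → (∀ k → evalTerm (h k) x μ ≡ C * t k) →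
  eval (applyUpTo h n) x μ ≡ C * sumTo n t
eval-applyUpTo zero    h x μ C t e = sym (ℤₚ.*-zeroʳ C)
eval-applyUpTo (suc n) h x μ C t e =
  trans (cong₂ _+_ (e 0) (eval-applyUpTo n (h ∘ suc) x μ C (t ∘ suc) (e ∘ suc)))
        (sym (ℤₚ.*-distribˡ-+ C (t 0) _))

module _ (i : ℕ) (es : List ℕ) (b : ℕ) (l : suc i ℕ.< length es) (x : Env) (μ : Functional) where
  private
    X = x i
    Y = x (suc i)
    p = get es i
    q = get es (suc i)

    evalTerm-split : ∀ c → evalTerm (mkTerm es b c) x μ ≡ c * ((X ^ p * Y ^ q) * (rest i es x * μ b))
    evalTerm-split c = cong (c *_) (trans (cong (_* μ b) (monomial-split i es x l))
                                          (ℤₚ.*-assoc (X ^ p * Y ^ q) _ _))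

    evalTerm-split-swap : ∀ c →
      evalTerm (mkTerm es b c) (swapEnv i x) μ ≡ c * ((Y ^ p * X ^ q) * (rest i es x * μ b))
    evalTerm-split-swap c
      rewrite monomial-split i es (swapEnv i x) l | swapEnv-left i x | swapEnv-right i x
            | rest-swapEnv i es x = cong (c *_) (ℤₚ.*-assoc (Y ^ p * X ^ q) _ _)

    eval-run : ∀ d a r c →
      (X - Y) * eval (map (λ k → mkTerm (set (set es i ((a ℕ.+ d) ∸ 1 ∸ k)) (suc i) (r ℕ.+ k)) b c) (upTo d)) x μ
        ≡ (c * (rest i es x * μ b)) * (X ^ (a ℕ.+ d) * Y ^ r - X ^ a * Y ^ (r ℕ.+ d))
    eval-run d a r c = begin
      (X - Y) * eval (map h (upTo d)) x μ      ≡⟨ cong (λ f → (X - Y) * eval f x μ) (map-upTo h d) ⟩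
      (X - Y) * eval (applyUpTo h d) x μ
        ≡⟨ cong ((X - Y) *_) (eval-applyUpTo d h x μ C t (λ k →
             trans (cong (λ m → c * (m * μ b)) (monomial-set₂ i es x ((a ℕ.+ d) ∸ 1 ∸ k) (r ℕ.+ k) l))
                   (collect c (t k) (rest i es x) (μ b)))) ⟩
      (X - Y) * (C * sumTo d t)                ≡⟨ to-front (X - Y) C _ ⟩
      C * ((X - Y) * sumTo d t)                ≡⟨ cong (C *_) (geometric X Y d a r) ⟩
      C * (X ^ (a ℕ.+ d) * Y ^ r - X ^ a * Y ^ (r ℕ.+ d)) ∎
      where
      open ≡-Reasoning
      h : ℕ → Term
      h k = mkTerm (set (set es i ((a ℕ.+ d) ∸ 1 ∸ k)) (suc i) (r ℕ.+ k)) b c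
      C = c * (rest i es x * μ b)
      t : ℕ → ℤ
      t k = X ^ ((a ℕ.+ d) ∸ 1 ∸ k) * Y ^ (r ℕ.+ k)
      collect : ∀ c t r m → c * ((t * r) * m) ≡ (c * (r * m)) * t
      collect = solve-∀

  eval-ddTerm : ∀ c → (X - Y) * eval (ddTerm i (mkTerm es b c)) x μ
    ≡ evalTerm (mkTerm es b c) x μ - evalTerm (mkTerm es b c) (swapEnv i x) μ
  eval-ddTerm c rewrite evalTerm-split c | evalTerm-split-swap c with q <ᵇ p in q<p
  ... | true = subst (λ n → (X - Y) * eval (map (λ k → mkTerm (set (set es i (n ∸ 1 ∸ k)) (suc i) (q ℕ.+ k)) b c) (upTo (p ∸ q))) x μ
                       ≡ c * ((X ^ p * Y ^ q) * (rest i es x * μ b)) - c * ((Y ^ p * X ^ q) * (rest i es x * μ b)))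
                 q+d (trans (eval-run (p ∸ q) q q c) (trans (cong (λ n → c * (rest i es x * μ b) * (X ^ n * Y ^ q - X ^ q * Y ^ n)) q+d)
                   (expand c (rest i es x) (μ b) (X ^ p) (Y ^ q) (X ^ q) (Y ^ p))))
    where
    q+d : q ℕ.+ (p ∸ q) ≡ p
    q+d = ℕₚ.m+[n∸m]≡n (ℕₚ.<⇒≤ (<ᵇ-true⁻¹ q<p))
    expand : ∀ c r m P Q P′ Q′ → c * (r * m) * (P * Q - P′ * Q′) ≡ c * ((P * Q) * (r * m)) - c * ((Q′ * P′) * (r * m))
    expand = solve-∀
  ... | false with p <ᵇ q in p<q
  ...   | true = subst (λ n → (X - Y) * eval (map (λ k → mkTerm (set (set es i (n ∸ 1 ∸ k)) (suc i) (p ℕ.+ k)) b (- c)) (upTo (q ∸ p))) x μ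
                       ≡ c * ((X ^ p * Y ^ q) * (rest i es x * μ b)) - c * ((Y ^ p * X ^ q) * (rest i es x * μ b)))
                 p+d (trans (eval-run (q ∸ p) p p (- c)) (trans (cong (λ n → - c * (rest i es x * μ b) * (X ^ n * Y ^ p - X ^ p * Y ^ n)) p+d)
                   (expand c (rest i es x) (μ b) (X ^ q) (Y ^ p) (X ^ p) (Y ^ q))))
    where
    p+d : p ℕ.+ (q ∸ p) ≡ q
    p+d = ℕₚ.m+[n∸m]≡n (ℕₚ.<⇒≤ (<ᵇ-true⁻¹ p<q))
    expand : ∀ c r m P Q P′ Q′ → - c * (r * m) * (P * Q - P′ * Q′) ≡ c * ((P′ * Q′) * (r * m)) - c * ((Q * P) * (r * m))
    expand = solve-∀
  ...   | false = trans (ℤₚ.*-zeroʳ (X - Y)) (sym (trans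
                    (cong (λ n → c * ((X ^ p * Y ^ n) * (rest i es x * μ b)) - c * ((Y ^ p * X ^ n) * (rest i es x * μ b))) q≡p)
                    (cancel c (X ^ p) (Y ^ p) (rest i es x * μ b))))
    where
    q≡p : q ≡ p
    q≡p = ℕₚ.≤-antisym (<ᵇ-false⁻¹ p<q) (<ᵇ-false⁻¹ q<p)
    cancel : ∀ c P Q r → c * ((P * Q) * r) - c * ((Q * P) * r) ≡ + 0
    cancel = solve-∀

-- Beyond the end of an exponent list `get` returns 0 and `set` does nothing, so a factor
-- `x (suc i)` would be lost silently. The formulas for the operators therefore need a lower bound
-- on the length of every exponent list.
Long : ℕ → Term → Set
Long n t = length (Term.exps t) ≡ n

length-set : ∀ es i v → length (set es i v) ≡ length es
length-set []       i       v = refl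
length-set (e ∷ es) zero    v = refl
length-set (e ∷ es) (suc i) v = cong suc (length-set es i v)

All-concatMap : ∀ {P : Term → Set} (h : Term → Poly) → (∀ t → P t → All P (h t)) →
  ∀ f → All P f → All P (concatMap h f)
All-concatMap h H []      []        = []
All-concatMap h H (t ∷ f) (pt ∷ pf) = Allₚ.++⁺ (H t pt) (All-concatMap h H f pf)

Long-ddTerm : ∀ {n} i t → Long n t → All (Long n) (ddTerm i t)
Long-ddTerm {n} i (mkTerm es b c) refl with get es (suc i) <ᵇ get es i
... | true = Allₚ.map⁺ (Allₚ.applyUpTo⁺₂ _ _ (λ k → trans (length-set (set es i _) (suc i) _) (length-set es i _)))
... | false with get es i <ᵇ get es (suc i)
...   | true = Allₚ.map⁺ (Allₚ.applyUpTo⁺₂ _ _ (λ k → trans (length-set (set es i _) (suc i) _) (length-set es i _)))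
...   | false = []

Long-mulOneBeta : ∀ {n} i f → All (Long n) f → All (Long n) (mulOneBeta i f)
Long-mulOneBeta i f = All-concatMap _ (λ { (mkTerm es b c) e → e ∷ trans (length-set es (suc i) _) e ∷ [] }) f

Long-piOp : ∀ {n} i f → All (Long n) f → All (Long n) (piOp i f)
Long-piOp i f l = All-concatMap (ddTerm i) (Long-ddTerm i) (mulOneBeta i f) (Long-mulOneBeta i f l)

eval-divDiff : ∀ i f x μ {n} → suc i ℕ.< n → All (Long n) f →
  (x i - x (suc i)) * eval (divDiff i f) x μ ≡ eval f x μ - eval f (swapEnv i x) μ
eval-divDiff i []      x μ i<n []         = ℤₚ.*-zeroʳ (x i - x (suc i))
eval-divDiff i (t@(mkTerm es b c) ∷ f) x μ i<n (refl ∷ l) = begin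
  (x i - x (suc i)) * eval (ddTerm i t ++ divDiff i f) x μ
    ≡⟨ cong ((x i - x (suc i)) *_) (eval-++ (ddTerm i t) (divDiff i f) x μ) ⟩
  (x i - x (suc i)) * (eval (ddTerm i t) x μ + eval (divDiff i f) x μ)
    ≡⟨ ℤₚ.*-distribˡ-+ (x i - x (suc i)) _ _ ⟩
  (x i - x (suc i)) * eval (ddTerm i t) x μ + (x i - x (suc i)) * eval (divDiff i f) x μ
    ≡⟨ cong₂ _+_ (eval-ddTerm i es b i<n x μ c) (eval-divDiff i f x μ i<n l) ⟩
  (evalTerm t x μ - evalTerm t (swapEnv i x) μ) + (eval f x μ - eval f (swapEnv i x) μ)
    ≡⟨ shuffle (evalTerm t x μ) (evalTerm t (swapEnv i x) μ) _ _ ⟩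
  (evalTerm t x μ + eval f x μ) - (evalTerm t (swapEnv i x) μ + eval f (swapEnv i x) μ) ∎
  where
  open ≡-Reasoning
  shuffle : ∀ a b c d → (a - b) + (c - d) ≡ (a + c) - (b + d)
  shuffle = solve-∀

eval-mulOneBeta : ∀ i f x μ {n} → suc i ℕ.< n → All (Long n) f →
  eval (mulOneBeta i f) x μ ≡ eval f x μ + x (suc i) * eval f x (S μ)
eval-mulOneBeta i []      x μ i<n []         = sym (trans (ℤₚ.+-identityˡ _) (ℤₚ.*-zeroʳ (x (suc i))))
eval-mulOneBeta i (mkTerm es b c ∷ f) x μ i<n (refl ∷ l) =
  trans (cong₂ (λ m r → c * (monomial es x * μ b) + (c * (m * μ (suc b)) + r))
               (monomial-set₁ i es x i<n) (eval-mulOneBeta i f x μ i<n l))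
        (shuffle c (monomial es x) (μ b) (x (suc i)) (μ (suc b)) (eval f x μ) (eval f x (S μ)))
  where
  shuffle : ∀ c M m y m′ F F′ → c * (M * m) + (c * ((y * M) * m′) + (F + y * F′))
    ≡ (c * (M * m) + F) + y * (c * (M * m′) + F′)
  shuffle = solve-∀

eval-piOp : ∀ i f x μ {n} → suc i ℕ.< n → All (Long n) f →
  (x i - x (suc i)) * eval (piOp i f) x μ
    ≡ (eval f x μ + x (suc i) * eval f x (S μ))
      - (eval f (swapEnv i x) μ + x i * eval f (swapEnv i x) (S μ))
eval-piOp i f x μ i<n l = trans (eval-divDiff i (mulOneBeta i f) x μ i<n (Long-mulOneBeta i f l))
  (cong₂ _-_ (eval-mulOneBeta i f x μ i<n l)
    (trans (eval-mulOneBeta i f (swapEnv i x) μ i<n l)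
           (cong (λ y → eval f (swapEnv i x) μ + y * eval f (swapEnv i x) (S μ)) (swapEnv-right i x))))

-- The column recursion

-- One row of weight `a`. A smaller first letter `e` passes in front of `b` with weight `a`, or
-- stays behind it with weight `1 + β a`, where `β a` is the 0-Hecke term of a crossing that is
-- absorbed. The last row has no letter to meet and carries no weight, in accordance with the
-- absence of the last variable.
op : ℤ → ℕ → (List ℕ → Val) → List ℕ → Val
op a b ψ []      μ = ψ (b ∷ []) μ
op a b ψ (e ∷ V) μ =
  if e <ᵇ b
  then (ψ (b ∷ e ∷ V) μ + a * ψ (b ∷ e ∷ V) (S μ)) + a * ψ (e ∷ b ∷ V) μ
  else ψ (b ∷ e ∷ V) μ

op-< : ∀ a b ψ e V μ → e ℕ.< b →
  op a b ψ (e ∷ V) μ ≡ (ψ (b ∷ e ∷ V) μ + a * ψ (b ∷ e ∷ V) (S μ)) + a * ψ (e ∷ b ∷ V) μ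
op-< a b ψ e V μ e<b rewrite <ᵇ-true e<b = refl

op-≥ : ∀ a b ψ e V μ → b ℕ.≤ e → op a b ψ (e ∷ V) μ ≡ ψ (b ∷ e ∷ V) μ
op-≥ a b ψ e V μ b≤e rewrite <ᵇ-false b≤e = refl

op-cong : ∀ a b {ψ ψ′ : List ℕ → Val} W →
  (∀ V → V ↭ b ∷ W → ∀ μ → ψ V μ ≡ ψ′ V μ) → ∀ μ → op a b ψ W μ ≡ op a b ψ′ W μ
op-cong a b []      h μ = h (b ∷ []) ↭-refl μ
op-cong a b (e ∷ V) h μ with e <ᵇ b
... | true  = cong₂ _+_ (cong₂ _+_ (h _ ↭-refl μ) (cong (a *_) (h _ ↭-refl (S μ))))
                        (cong (a *_) (h _ (swap e b ↭-refl) μ))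
... | false = h _ ↭-refl μ

-- Expansion of the first column of a pipe dream of  A 1 B  (in 0-Hecke form):
-- the words W enumerated by  col (suc (length A)) x B  are those for which  A W
-- is the permutation left after removing the column, and x k is the weight of row k.
col : ℕ → Env → List ℕ → (List ℕ → Val) → Val
col k x []      ψ = ψ []
col k x (b ∷ B) ψ = col (suc k) x B (op (x k) b ψ)

-- The range of `j` stops one short of the last row because `op` ignores its weight on the empty
-- word. `g-cong` inherits this, and it supplies the symmetry needed for ascents at the end of a
-- word.
col-cong : ∀ k x x′ B {ψ ψ′ : List ℕ → Val} →
  (∀ j → k ℕ.≤ j → suc j ℕ.< k ℕ.+ length B → x j ≡ x′ j) →
  (∀ W → W ↭ B → ∀ μ → ψ W μ ≡ ψ′ W μ) → ∀ μ → col k x B ψ μ ≡ col k x′ B ψ′ μ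
col-cong k x x′ []      hx hψ μ = hψ [] ↭-refl μ
col-cong k x x′ (b ∷ B) {ψ} {ψ′} hx hψ =
  col-cong (suc k) x x′ B
    (λ j k<j lt → hx j (ℕₚ.<⇒≤ k<j) (subst (suc j ℕ.<_) (sym (ℕₚ.+-suc k (length B))) lt)) step
  where
  step : ∀ W → W ↭ B → ∀ μ → op (x k) b ψ W μ ≡ op (x′ k) b ψ′ W μ
  step []      p μ = hψ (b ∷ []) (prep b p) μ
  step (e ∷ V) p μ = trans (op-cong (x k) b (e ∷ V) (λ V′ q → hψ V′ (↭-trans q (prep b p))) μ)
    (cong (λ a → op a b ψ′ (e ∷ V) μ) (hx k ℕₚ.≤-refl
      (subst (suc k ℕ.<_) (trans (sym (ℕₚ.+-suc k _)) (cong (λ n → k ℕ.+ suc n) (↭-length p)))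
        (s≤s (subst (k ℕ.<_) (sym (ℕₚ.+-suc k (length V))) (s≤s (ℕₚ.m≤m+n k (length V))))))))

prodTo : ℕ → Env → ℤ
prodTo zero    x = + 1
prodTo (suc n) x = prodTo n x * x n

prodTo-cong : ∀ n {x x′ : Env} → (∀ j → j ℕ.< n → x j ≡ x′ j) → prodTo n x ≡ prodTo n x′
prodTo-cong zero    h = refl
prodTo-cong (suc n) h = cong₂ _*_ (prodTo-cong n (λ j j<n → h j (ℕₚ.m<n⇒m<1+n j<n))) (h n ℕₚ.≤-refl)

splitOn : ℕ → List ℕ → Maybe (List ℕ × List ℕ)
splitOn m []      = nothing
splitOn m (a ∷ w) with a ℕ.≟ m
... | yes _ = just ([] , w)
... | no  _ = Maybe.map (λ { (A , B) → a ∷ A , B }) (splitOn m w)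

splitOn-just : ∀ m w {A B} → splitOn m w ≡ just (A , B) → w ≡ A ++ m ∷ B
splitOn-just m (a ∷ w) eq with a ℕ.≟ m
splitOn-just m (a ∷ w) refl | yes refl = refl
splitOn-just m (a ∷ w) eq   | no _ with splitOn m w in eq′
splitOn-just m (a ∷ w) refl | no _ | just _ = cong (a ∷_) (splitOn-just m w eq′)

-- Grothendieck polynomials of words with letters in [m, m + fuel), computed by
-- removing the smallest letter.
mutual
  g : ℕ → ℕ → List ℕ → Env → Val
  g zero    m w x μ = μ 0
  g (suc f) m w = removeMin f m (splitOn m w) w

  removeMin : ℕ → ℕ → Maybe (List ℕ × List ℕ) → List ℕ → Env → Val
  removeMin f m nothing        w x μ = g f (suc m) w x μ
  removeMin f m (just (A , B)) w x μ =
    prodTo (length A) x * col (suc (length A)) x B (λ W → g f (suc m) (A ++ W) x) μ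

-- A Grothendieck polynomial does not involve the variable of the last position.
g-cong : ∀ f m w {x x′ : Env} → (∀ j → suc j ℕ.< length w → x j ≡ x′ j) →
  ∀ μ → g f m w x μ ≡ g f m w x′ μ
g-cong zero    m w h μ = refl
g-cong (suc f) m w h μ with splitOn m w in eq
... | nothing      = g-cong f (suc m) w h μ
g-cong (suc f) m w {x} {x′} h μ | just (A , B) =
  cong₂ _*_ (prodTo-cong (length A) (λ j j<A → h j (<w (ℕₚ.≤-trans (s≤s j<A) (s≤s (ℕₚ.m≤m+n _ _))))))
    (col-cong (suc (length A)) x x′ B (λ j _ lt → h j (<w lt))
      (λ W p → g-cong f (suc m) (A ++ W) (λ j lt → h j (<w (ℕₚ.m<n⇒m<1+n
         (subst (suc j ℕ.<_) (trans (length-++ A) (cong (length A ℕ.+_) (↭-length p))) lt))))) μ)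
  where
  <w : ∀ {j} → j ℕ.< suc (length A) ℕ.+ length B → j ℕ.< length w
  <w {j} = subst (j ℕ.<_) (sym (trans (cong length (splitOn-just m w eq))
                 (trans (length-++ A) (ℕₚ.+-suc (length A) (length B)))))

-- Calculus of the relation f = π_i f′ on values

Family : Set
Family = Env → Val

-- f = π_i f′, as an identity of values at points where the divided difference makes sense.
record Rel (i : ℕ) (f f′ : Family) : Set where
  field
    at : ∀ x → x i ≢ x (suc i) → ∀ μ →
      (x i - x (suc i)) * f x μ
        ≡ (f′ x μ + x (suc i) * f′ x (S μ))
          - (f′ (swapEnv i x) μ + x i * f′ (swapEnv i x) (S μ))
open Rel

record Invariant (i : ℕ) (f : Family) : Set where
  constructor invariant
  field
    under-swap : ∀ x → x i ≢ x (suc i) → ∀ μ → f (swapEnv i x) μ ≡ f x μ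
open Invariant

record Extensional (f : Family) : Set where
  constructor extensional
  field
    resp : ∀ x x′ → (∀ j → x j ≡ x′ j) → ∀ μ → f x μ ≡ f x′ μ
open Extensional

cancel-difference : ∀ {a b} c d → a ≢ b → (a - b) * c ≡ (a - b) * d → c ≡ d
cancel-difference {a} {b} c d a≢b =
  ℤₚ.*-cancelˡ-≡ (a - b) c d {{≢-nonZero (a≢b ∘ ℤₚ.i-j≡0⇒i≡j a b)}}

swapEnv-≢ : ∀ i x → x i ≢ x (suc i) → swapEnv i x i ≢ swapEnv i x (suc i)
swapEnv-≢ i x ne e = ne (sym (trans (sym (swapEnv-left i x)) (trans e (swapEnv-right i x))))

-- Exchanging the two variables negates both the right side of `at` and the factor in front of `f`,
-- so that factor cancels.
Rel⇒Invariant : ∀ i {f f′} → Rel i f f′ → Extensional f′ → Invariant i f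
under-swap (Rel⇒Invariant i {f} {f′} r ext) x ne μ = cancel-difference _ _ ne (begin
  (X - Y) * f sx μ                                             ≡⟨ flip₁ X Y (f sx μ) ⟩
  - ((Y - X) * f sx μ)
    ≡⟨ cong₂ (λ a b → - ((a - b) * f sx μ)) (swapEnv-left i x) (swapEnv-right i x) ⟨
  - ((sx i - sx (suc i)) * f sx μ)                             ≡⟨ cong -_ (at r sx (swapEnv-≢ i x ne) μ) ⟩
  - ((f′ sx μ + sx (suc i) * f′ sx (S μ)) - (f′ ssx μ + sx i * f′ ssx (S μ)))
    ≡⟨ cong₂ (λ a b → - ((f′ sx μ + b * f′ sx (S μ)) - (f′ ssx μ + a * f′ ssx (S μ)))) (swapEnv-left i x) (swapEnv-right i x) ⟩
  - ((f′ sx μ + X * f′ sx (S μ)) - (f′ ssx μ + Y * f′ ssx (S μ)))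
    ≡⟨ cong₂ (λ a b → - ((f′ sx μ + X * f′ sx (S μ)) - (a + Y * b))) (back μ) (back (S μ)) ⟩
  - ((f′ sx μ + X * f′ sx (S μ)) - (f′ x μ + Y * f′ x (S μ)))
    ≡⟨ flip₂ (f′ sx μ + X * f′ sx (S μ)) (f′ x μ + Y * f′ x (S μ)) ⟩
  (f′ x μ + Y * f′ x (S μ)) - (f′ sx μ + X * f′ sx (S μ))      ≡⟨ at r x ne μ ⟨
  (X - Y) * f x μ ∎)
  where
  open ≡-Reasoning
  X = x i
  Y = x (suc i)
  sx ssx : Env
  sx = swapEnv i x
  ssx = swapEnv i sx
  back : ∀ μ → f′ ssx μ ≡ f′ x μ
  back = resp ext _ _ (swapEnv-involutive i x)
  flip₁ : ∀ X Y F → (X - Y) * F ≡ - ((Y - X) * F)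
  flip₁ = solve-∀
  flip₂ : ∀ A B → - (A - B) ≡ B - A
  flip₂ = solve-∀

Rel-resp : ∀ {i f f′ h h′} → (∀ x μ → h x μ ≡ f x μ) → (∀ x μ → h′ x μ ≡ f′ x μ) → Rel i f f′ → Rel i h h′
at (Rel-resp {i} e e′ r) x ne μ = trans (cong ((x i - x (suc i)) *_) (e x μ)) (trans (at r x ne μ)
  (sym (cong₂ _-_ (cong₂ _+_ (e′ x μ) (cong (x (suc i) *_) (e′ x (S μ))))
                  (cong₂ _+_ (e′ _ μ) (cong (x i *_) (e′ _ (S μ)))))))

Rel-+ : ∀ {i f f′ h h′} → Rel i f f′ → Rel i h h′ →
  Rel i (λ x μ → f x μ + h x μ) (λ x μ → f′ x μ + h′ x μ)
at (Rel-+ {i} {f} {f′} {h} {h′} r s) x ne μ =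
  trans (ℤₚ.*-distribˡ-+ (x i - x (suc i)) _ _) (trans (cong₂ _+_ (at r x ne μ) (at s x ne μ))
    (shuffle (x i) (x (suc i)) (f′ x μ) (f′ x (S μ)) (f′ sx μ) (f′ sx (S μ)) (h′ x μ) (h′ x (S μ)) (h′ sx μ) (h′ sx (S μ))))
  where
  sx = swapEnv i x
  shuffle : ∀ X Y a b c d a′ b′ c′ d′ → ((a + Y * b) - (c + X * d)) + ((a′ + Y * b′) - (c′ + X * d′))
    ≡ ((a + a′) + Y * (b + b′)) - ((c + c′) + X * (d + d′))
  shuffle = solve-∀

Rel-* : ∀ {i f f′} (c : Env → ℤ) → (∀ x → c (swapEnv i x) ≡ c x) → Rel i f f′ →
  Rel i (λ x μ → c x * f x μ) (λ x μ → c x * f′ x μ)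
at (Rel-* {i} {f} {f′} c inv r) x ne μ rewrite inv x =
  trans (shuffle₁ (x i) (x (suc i)) (c x) (f x μ)) (trans (cong (c x *_) (at r x ne μ))
    (shuffle₂ (x i) (x (suc i)) (c x) (f′ x μ) (f′ x (S μ)) _ _))
  where
  shuffle₁ : ∀ X Y c a → (X - Y) * (c * a) ≡ c * ((X - Y) * a)
  shuffle₁ = solve-∀
  shuffle₂ : ∀ X Y c a b a′ b′ → c * ((a + Y * b) - (a′ + X * b′))
    ≡ (c * a + Y * (c * b)) - (c * a′ + X * (c * b′))
  shuffle₂ = solve-∀

Rel-S : ∀ {i f f′} → Rel i f f′ → Rel i (λ x μ → f x (S μ)) (λ x μ → f′ x (S μ))
at (Rel-S r) x ne μ = at r x ne (S μ)

-- π_i is linear over functions symmetric in the two variables, and π_i x_i = ∂_i (x_i + β x_i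
-- x_{i+1}) = 1.
Rel-variable : ∀ i {f} → Invariant i f → Rel i f (λ x μ → x i * f x μ)
at (Rel-variable i {f} inv) x ne μ rewrite under-swap inv x ne μ | under-swap inv x ne (S μ) | swapEnv-left i x =
  lemma (x i) (x (suc i)) (f x μ) (f x (S μ))
  where
  lemma : ∀ X Y a b → (X - Y) * a ≡ (X * a + Y * (X * b)) - (Y * a + X * (Y * b))
  lemma = solve-∀

-- π_i (1 + β x_i) = 0, since (1 + β x_i)(1 + β x_{i+1}) is symmetric.
Rel-kernel : ∀ i {f} → Invariant i f → Rel i (λ x μ → + 0) (λ x μ → f x μ + x i * f x (S μ))
at (Rel-kernel i {f} inv) x ne μ
  rewrite under-swap inv x ne μ | under-swap inv x ne (S μ) | under-swap inv x ne (S (S μ)) | swapEnv-left i x =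
  lemma (x i) (x (suc i)) (f x μ) (f x (S μ)) (f x (S (S μ)))
  where
  lemma : ∀ X Y a b c → (X - Y) * + 0 ≡ ((a + X * b) + Y * (b + X * c)) - ((a + Y * b) + X * (b + Y * c))
  lemma = solve-∀

-- The Leibniz rule ∂_i (x_i h) = h + x_{i+1} ∂_i h for h = (1 + β x_{i+1}) f′.
Rel-leibniz : ∀ i {f f′} → Rel i f f′ →
  Rel i (λ x μ → (f′ x μ + x (suc i) * f′ x (S μ)) + x (suc i) * f x μ) (λ x μ → x i * f′ x μ)
at (Rel-leibniz i {f} {f′} r) x ne μ rewrite swapEnv-left i x =
  trans (expand X Y (f′ x μ) (f′ x (S μ)) (f x μ)) (trans
    (cong (λ z → (X - Y) * (f′ x μ + Y * f′ x (S μ)) + Y * z) (at r x ne μ))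
    (collect X Y (f′ x μ) (f′ x (S μ)) _ _))
  where
  X = x i
  Y = x (suc i)
  expand : ∀ X Y a b z → (X - Y) * ((a + Y * b) + Y * z) ≡ (X - Y) * (a + Y * b) + Y * ((X - Y) * z)
  expand = solve-∀
  collect : ∀ X Y a b a′ b′ → (X - Y) * (a + Y * b) + Y * ((a + Y * b) - (a′ + X * b′))
    ≡ (X * a + Y * (X * b)) - (Y * a′ + X * (Y * b′))
  collect = solve-∀

-- `Rel-leibniz` plus the symmetric multiple β x_i x_{i+1} of f = π_i f′.
Rel-leibniz₂ : ∀ i {f f′} → Rel i f f′ →
  Rel i (λ x μ → (f′ x μ + x (suc i) * f′ x (S μ)) + x (suc i) * (f x μ + x i * f x (S μ)))
        (λ x μ → x i * f′ x μ + x (suc i) * (x i * f′ x (S μ)))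
at (Rel-leibniz₂ i {f} {f′} r) x ne μ rewrite swapEnv-left i x | swapEnv-right i x =
  trans (expand X Y (f′ x μ) (f′ x (S μ)) (f x μ) (f x (S μ))) (trans
    (cong₂ (λ z z′ → (X - Y) * (f′ x μ + Y * f′ x (S μ)) + Y * (z + X * z′)) (at r x ne μ) (at r x ne (S μ)))
    (collect X Y (f′ x μ) (f′ x (S μ)) (f′ x (S (S μ))) _ _ _))
  where
  X = x i
  Y = x (suc i)
  expand : ∀ X Y a b z z′ → (X - Y) * ((a + Y * b) + Y * (z + X * z′))
    ≡ (X - Y) * (a + Y * b) + Y * ((X - Y) * z + X * ((X - Y) * z′))
  expand = solve-∀
  collect : ∀ X Y a b c a′ b′ c′ →
    (X - Y) * (a + Y * b) + Y * (((a + Y * b) - (a′ + X * b′)) + X * ((b + Y * c) - (b′ + X * c′)))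
    ≡ ((X * a + Y * (X * b)) + Y * (X * b + Y * (X * c))) - ((Y * a′ + X * (Y * b′)) + X * (Y * b′ + X * (Y * c′)))
  collect = solve-∀

-- The first summand is the symmetric multiple (1 + β x_i)(1 + β x_{i+1}) f′, with image (1 + β
-- x_i)(1 + β x_{i+1}) f. The second is x_{i+1} (1 + β x_i) f with f symmetric, and its image is the
-- negative of this.
Rel-kernel₂ : ∀ i {f f′} → Rel i f f′ → Extensional f′ →
  Rel i (λ x μ → + 0)
        (λ x μ → ((f′ x μ + x i * f′ x (S μ)) + x (suc i) * (f′ x (S μ) + x i * f′ x (S (S μ))))
                 + x (suc i) * (f x μ + x i * f x (S μ)))
at (Rel-kernel₂ i {f} {f′} r ext) x ne μ
  rewrite swapEnv-left i x | swapEnv-right i x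
        | under-swap (Rel⇒Invariant i r ext) x ne μ | under-swap (Rel⇒Invariant i r ext) x ne (S μ) | under-swap (Rel⇒Invariant i r ext) x ne (S (S μ)) =
  sym (trans (expand X Y (f′ x μ) (f′ x (S μ)) (f′ x (S (S μ))) (f′ x (S (S (S μ))))
                         (f′ sx μ) (f′ sx (S μ)) (f′ sx (S (S μ))) (f′ sx (S (S (S μ)))) (f x μ) (f x (S μ)) (f x (S (S μ))))
      (trans (cong₂ (λ u v → (u - (X - Y) * f x μ) + (X + Y) * (v - (X - Y) * f x (S μ))
               + X * Y * (((f′ x (S (S μ)) + Y * f′ x (S (S (S μ)))) - (f′ sx (S (S μ)) + X * f′ sx (S (S (S μ))))) - (X - Y) * f x (S (S μ))))
               (sym (at r x ne μ)) (sym (at r x ne (S μ))))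
      (trans (cong (λ u → ((X - Y) * f x μ - (X - Y) * f x μ) + (X + Y) * ((X - Y) * f x (S μ) - (X - Y) * f x (S μ))
               + X * Y * (u - (X - Y) * f x (S (S μ)))) (sym (at r x ne (S (S μ)))))
        (vanish X Y (f x μ) (f x (S μ)) (f x (S (S μ)))))))
  where
  X = x i
  Y = x (suc i)
  sx = swapEnv i x
  expand : ∀ X Y p₀ p₁ p₂ p₃ q₀ q₁ q₂ q₃ a b c →
    ((((p₀ + X * p₁) + Y * (p₁ + X * p₂)) + Y * (a + X * b)) + Y * (((p₁ + X * p₂) + Y * (p₂ + X * p₃)) + Y * (b + X * c)))
    - ((((q₀ + Y * q₁) + X * (q₁ + Y * q₂)) + X * (a + Y * b)) + X * (((q₁ + Y * q₂) + X * (q₂ + Y * q₃)) + X * (b + Y * c)))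
    ≡ (((p₀ + Y * p₁) - (q₀ + X * q₁)) - (X - Y) * a) + (X + Y) * (((p₁ + Y * p₂) - (q₁ + X * q₂)) - (X - Y) * b)
      + X * Y * (((p₂ + Y * p₃) - (q₂ + X * q₃)) - (X - Y) * c)
  expand = solve-∀
  vanish : ∀ X Y a b c → ((X - Y) * a - (X - Y) * a) + (X + Y) * ((X - Y) * b - (X - Y) * b)
    + X * Y * ((X - Y) * c - (X - Y) * c) ≡ (X - Y) * + 0
  vanish = solve-∀

-- The column recursion commutes with the π_i

Unique-resp-↭ : ∀ {v w : List ℕ} → v ↭ w → Unique v → Unique w
Unique-resp-↭ p = ↭ₛ.Unique-resp-↭ (setoid ℕ) (↭⇒↭ₛ p)

Unique-drop : ∀ A {w : List ℕ} → Unique (A ++ w) → Unique w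
Unique-drop []      u       = u
Unique-drop (_ ∷ A) (_ ∷ u) = Unique-drop A u

op-Rel : ∀ {i : ℕ} (c : Env → ℤ) → (∀ x → c (swapEnv i x) ≡ c x) →
  ∀ (φ φ′ : Env → List ℕ → Val) b e V V′ →
  Rel i (λ x → φ x (b ∷ e ∷ V)) (λ x → φ′ x (b ∷ e ∷ V′)) →
  Rel i (λ x → φ x (e ∷ b ∷ V)) (λ x → φ′ x (e ∷ b ∷ V′)) →
  Rel i (λ x → op (c x) b (φ x) (e ∷ V)) (λ x → op (c x) b (φ′ x) (e ∷ V′))
op-Rel c inv φ φ′ b e V V′ r r′ with e ℕ.<? b
... | yes e<b = Rel-resp (λ x μ → op-< (c x) b (φ x) e V μ e<b) (λ x μ → op-< (c x) b (φ′ x) e V′ μ e<b)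
                  (Rel-+ (Rel-+ r (Rel-* c inv (Rel-S r))) (Rel-* c inv r′))
... | no  e≮b = Rel-resp (λ x μ → op-≥ (c x) b (φ x) e V μ (ℕₚ.≮⇒≥ e≮b))
                         (λ x μ → op-≥ (c x) b (φ′ x) e V′ μ (ℕₚ.≮⇒≥ e≮b)) r

op-Extensional : ∀ (c : Env → ℤ) → (∀ x x′ → (∀ j → x j ≡ x′ j) → c x ≡ c x′) → ∀ (φ : Env → List ℕ → Val) b W →
  (∀ V → Extensional (λ x → φ x V)) → Extensional (λ x → op (c x) b (φ x) W)
op-Extensional c hc φ b W ext = extensional λ x x′ h μ →
  trans (op-cong (c x) b W (λ V _ → Extensional.resp (ext V) x x′ h) μ) (cong (λ a → op a b (φ x′) W μ) (hc x x′ h))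

col-Rel : ∀ i k B {φ φ′ : Env → List ℕ → Val} → suc i ℕ.< k →
  (∀ W → W ↭ B → Rel i (λ x → φ x W) (λ x → φ′ x W)) →
  Rel i (λ x → col k x B (φ x)) (λ x → col k x B (φ′ x))
col-Rel i k []      i<k h = h [] ↭-refl
col-Rel i k (b ∷ B) {φ} {φ′} i<k h = col-Rel i (suc k) B (ℕₚ.m<n⇒m<1+n i<k) step
  where
  step : ∀ W → W ↭ B → Rel i (λ x → op (x k) b (φ x) W) (λ x → op (x k) b (φ′ x) W)
  step []      p = h (b ∷ []) (prep b p)
  step (e ∷ V) p = op-Rel (λ x → x k) (λ x → swapEnv-> i x k i<k) φ φ′ b e V V
    (h _ (prep b p)) (h _ (↭-trans (swap e b ↭-refl) (prep b p)))

col-scale : ∀ k x B c (ψ : List ℕ → Val) μ → col k x B (λ W μ → c * ψ W μ) μ ≡ c * col k x B ψ μ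
col-scale k x []      c ψ μ = refl
col-scale k x (b ∷ B) c ψ μ =
  trans (col-cong (suc k) x x B (λ _ _ _ → refl) (λ W _ μ → step W μ) μ)
        (col-scale (suc k) x B c (op (x k) b ψ) μ)
  where
  expand : ∀ c a p q r → (c * p + a * (c * q)) + a * (c * r) ≡ c * ((p + a * q) + a * r)
  expand = solve-∀
  step : ∀ W μ → op (x k) b (λ W μ → c * ψ W μ) W μ ≡ c * op (x k) b ψ W μ
  step []      μ = refl
  step (e ∷ V) μ with e <ᵇ b
  ... | true  = expand c (x k) _ _ _
  ... | false = refl

-- The ascent whose smaller letter is the minimum. After the swap, row `i` lies entirely to the left
-- of the minimum, whence the factor `x i`, and `v` has left the expanded part. It remains to
-- evaluate π_i (x_i f′), by the Leibniz rule if `v` met a smaller letter and by symmetry otherwise.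
col-Rel-ascent-at-min : ∀ i v Y {ψ : Env → List ℕ → Val} → Unique (v ∷ Y) →
  (∀ W → Extensional (λ x → ψ x W)) →
  (Y ≡ [] → Invariant i (λ x → ψ x (v ∷ []))) →
  (∀ a b V → a ∷ b ∷ V ↭ v ∷ Y → a ℕ.< b → Rel i (λ x → ψ x (a ∷ b ∷ V)) (λ x → ψ x (b ∷ a ∷ V))) →
  Rel i (λ x → col (suc i) x (v ∷ Y) (ψ x)) (λ x μ → x i * col (suc (suc i)) x Y (λ W → ψ x (v ∷ W)) μ)
col-Rel-ascent-at-min i v Y {ψ} uniq ext inv rel =
  Rel-resp (λ _ _ → refl) (λ x μ → sym (col-scale (suc (suc i)) x Y (x i) (λ W → ψ x (v ∷ W)) μ))
    (col-Rel i (suc (suc i)) Y ℕₚ.≤-refl step)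
  where
  step : ∀ W → W ↭ Y → Rel i (λ x → op (x (suc i)) v (ψ x) W) (λ x μ → x i * ψ x (v ∷ W) μ)
  step []      p = Rel-variable i (inv (↭-empty-inv (↭-sym p)))
  step (e ∷ V) p with ℕₚ.<-cmp e v
  ... | tri< e<v _ _ = Rel-resp (λ x μ → op-< (x (suc i)) v (ψ x) e V μ e<v) (λ _ _ → refl)
                         (Rel-leibniz i (rel e v V (↭-trans (swap e v ↭-refl) (prep v p)) e<v))
  ... | tri> _ _ v<e = Rel-resp (λ x μ → op-≥ (x (suc i)) v (ψ x) e V μ (ℕₚ.<⇒≤ v<e)) (λ _ _ → refl)
                         (Rel-variable i (Rel⇒Invariant i (rel v e V (prep v p) v<e) (ext _)))
  ... | tri≈ _ refl _ = ⊥-elim (All.head (AllPairs.head (Unique-resp-↭ (prep e (↭-sym p)) uniq)) refl)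

-- Only the first letter `e` of an outcome of `Y` interacts with `u` and `v`, which leaves three
-- relative orders. Each time the expansion for `v u` splits into a part killed by π_i, recorded as
-- `+ 0` on the other side, and parts whose images make up the expansion for `u v`.
col-Rel-ascent₀ : ∀ i u v Y {φ : Env → List ℕ → Val} → u ℕ.< v → Unique (u ∷ v ∷ Y) →
  (∀ W → Extensional (λ x → φ x W)) →
  (Y ≡ [] → ∀ W → W ↭ u ∷ v ∷ [] → Invariant i (λ x → φ x W)) →
  (∀ c a b V → c ∷ a ∷ b ∷ V ↭ u ∷ v ∷ Y → a ℕ.< b →
    Rel i (λ x → φ x (c ∷ a ∷ b ∷ V)) (λ x → φ x (c ∷ b ∷ a ∷ V))) →
  Rel i (λ x → col i x (u ∷ v ∷ Y) (φ x)) (λ x → col i x (v ∷ u ∷ Y) (φ x))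
col-Rel-ascent₀ i u v Y {φ} u<v uniq ext inv rel = col-Rel i (suc (suc i)) Y ℕₚ.≤-refl step
  where
  step : ∀ W → W ↭ Y → Rel i (λ x → op (x (suc i)) v (op (x i) u (φ x)) W)
                             (λ x → op (x (suc i)) u (op (x i) v (φ x)) W)
  step []      p = Rel-resp
    (λ x μ → trans (op-≥ (x i) u (φ x) v [] μ (ℕₚ.<⇒≤ u<v)) (sym (ℤₚ.+-identityˡ _)))
    (λ x μ → op-< (x i) v (φ x) u [] μ u<v)
    (Rel-+ (Rel-kernel i (inv (↭-empty-inv (↭-sym p)) _ (swap v u ↭-refl))) (Rel-variable i (inv (↭-empty-inv (↭-sym p)) _ ↭-refl)))
  step (e ∷ V) p with ℕₚ.<-cmp u e | ℕₚ.<-cmp v e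
  ... | tri≈ _ refl _ | _ = ⊥-elim (All.head (All.tail (AllPairs.head
                              (Unique-resp-↭ (prep u (prep v (↭-sym p))) uniq))) refl)
  ... | _ | tri≈ _ refl _ = ⊥-elim (All.head (AllPairs.head (AllPairs.tail
                              (Unique-resp-↭ (prep u (prep v (↭-sym p))) uniq))) refl)
  ... | tri> _ _ e<u | tri< v<e _ _ = ⊥-elim (ℕₚ.<-asym e<u (ℕₚ.<-trans u<v v<e))
  ... | tri< u<e _ _ | tri< v<e _ _ = Rel-resp
    (λ x μ → trans (op-≥ (x (suc i)) v (op (x i) u (φ x)) e V μ (ℕₚ.<⇒≤ v<e))
              (trans (op-≥ (x i) u (φ x) v (e ∷ V) μ (ℕₚ.<⇒≤ u<v)) (sym (ℤₚ.+-identityˡ _))))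
    (λ x μ → trans (op-≥ (x (suc i)) u (op (x i) v (φ x)) e V μ (ℕₚ.<⇒≤ u<e))
                   (op-< (x i) v (φ x) u (e ∷ V) μ u<v))
    (Rel-+ (Rel-kernel i (Rel⇒Invariant i (rel v u e V (↭-trans (swap v u ↭-refl) (prep u (prep v p))) u<e) (ext _)))
           (Rel-variable i (Rel⇒Invariant i (rel u v e V (prep u (prep v p)) v<e) (ext _))))
  ... | tri< u<e _ _ | tri> _ _ e<v = Rel-resp
    (λ x μ → trans (trans (op-< (x (suc i)) v (op (x i) u (φ x)) e V μ e<v)
       (cong₂ _+_ (cong₂ _+_ (op-≥ (x i) u (φ x) v (e ∷ V) μ (ℕₚ.<⇒≤ u<v))
                             (cong (x (suc i) *_) (op-≥ (x i) u (φ x) v (e ∷ V) (S μ) (ℕₚ.<⇒≤ u<v))))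
                  (cong (x (suc i) *_) (op-≥ (x i) u (φ x) e (v ∷ V) μ (ℕₚ.<⇒≤ u<e))))) (sym (ℤₚ.+-identityˡ _)))
    (λ x μ → trans (op-≥ (x (suc i)) u (op (x i) v (φ x)) e V μ (ℕₚ.<⇒≤ u<e))
                   (op-< (x i) v (φ x) u (e ∷ V) μ u<v))
    (Rel-+ (Rel-kernel i (Rel⇒Invariant i (rel v u e V (↭-trans (swap v u ↭-refl) (prep u (prep v p))) u<e) (ext _)))
           (Rel-leibniz i (rel u e v V (prep u (↭-trans (swap e v ↭-refl) (prep v p))) e<v)))
  ... | tri> _ _ e<u | tri> _ _ e<v = Rel-resp
    (λ x μ → trans (op-< (x (suc i)) v (op (x i) u (φ x)) e V μ e<v)
       (trans (cong₂ _+_ (cong₂ _+_ (op-≥ (x i) u (φ x) v (e ∷ V) μ (ℕₚ.<⇒≤ u<v))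
                             (cong (x (suc i) *_) (op-≥ (x i) u (φ x) v (e ∷ V) (S μ) (ℕₚ.<⇒≤ u<v))))
                  (cong (x (suc i) *_) (op-< (x i) u (φ x) e (v ∷ V) μ e<u)))
        (regroup (x i) (x (suc i)) (φ x (u ∷ v ∷ e ∷ V) μ) (φ x (u ∷ v ∷ e ∷ V) (S μ))
          (φ x (u ∷ e ∷ v ∷ V) μ) (φ x (u ∷ e ∷ v ∷ V) (S μ)) (φ x (e ∷ u ∷ v ∷ V) μ))))
    (λ x μ → trans (op-< (x (suc i)) u (op (x i) v (φ x)) e V μ e<u)
       (trans (cong₂ _+_ (cong₂ _+_ (op-< (x i) v (φ x) u (e ∷ V) μ u<v)
                             (cong (x (suc i) *_) (op-< (x i) v (φ x) u (e ∷ V) (S μ) u<v)))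
                  (cong (x (suc i) *_) (op-< (x i) v (φ x) e (u ∷ V) μ e<v)))
        (regroup′ (x i) (x (suc i))
          (φ x (v ∷ u ∷ e ∷ V) μ) (φ x (v ∷ u ∷ e ∷ V) (S μ)) (φ x (v ∷ u ∷ e ∷ V) (S (S μ)))
          (φ x (u ∷ v ∷ e ∷ V) μ) (φ x (u ∷ v ∷ e ∷ V) (S μ))
          (φ x (v ∷ e ∷ u ∷ V) μ) (φ x (v ∷ e ∷ u ∷ V) (S μ)) (φ x (e ∷ v ∷ u ∷ V) μ))))
    -- Words are grouped by their first letter: those starting with `v` are killed, those starting
    -- with `u` follow the Leibniz rule, and those starting with `e` carry the symmetric weight x_i
    -- x_{i+1}.
    (Rel-+ (Rel-+ (Rel-kernel₂ i (rel v e u V (↭-trans (prep v (swap e u ↭-refl)) (↭-trans (swap v u ↭-refl) (prep u (prep v p)))) e<u) (ext _))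
                  (Rel-leibniz₂ i (rel u e v V (prep u (↭-trans (swap e v ↭-refl) (prep v p))) e<v)))
           (Rel-* (λ x → x i * x (suc i))
             (λ x → trans (cong₂ _*_ (swapEnv-left i x) (swapEnv-right i x)) (ℤₚ.*-comm (x (suc i)) (x i)))
             (rel e u v V (↭-trans (swap e u ↭-refl) (prep u (↭-trans (swap e v ↭-refl) (prep v p)))) u<v)))
    where
    regroup : ∀ X Y a b c d e → (a + Y * b) + Y * ((c + X * d) + X * e)
      ≡ (+ 0 + ((a + Y * b) + Y * (c + X * d))) + (X * Y) * e
    regroup = solve-∀
    regroup′ : ∀ X Y p₀ p₁ p₂ a₀ a₁ q₀ q₁ d → (((p₀ + X * p₁) + X * a₀) + Y * ((p₁ + X * p₂) + X * a₁)) + Y * ((q₀ + X * q₁) + X * d)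
      ≡ ((((p₀ + X * p₁) + Y * (p₁ + X * p₂)) + Y * (q₀ + X * q₁)) + (X * a₀ + Y * (X * a₁))) + (X * Y) * d
    regroup′ = solve-∀

-- Letters before the ascent are absorbed into `φ` through `op`; their weights lie in rows before
-- `i` and are unaffected by the swap. Once the minimum is removed, positions `i` and `suc i` have
-- one more letter of the outcome in front of them than `B₀` has, hence `suc (length B₀)`. If `Y` is
-- empty there is no position `suc i` left, and position `i` is the last, whose variable does not
-- occur; hence the invariance hypothesis.
col-Rel-ascent : ∀ B₀ i k u v Y {φ : Env → List ℕ → Val} → i ≡ length B₀ ℕ.+ k →
  u ℕ.< v → Unique (B₀ ++ u ∷ v ∷ Y) →
  (∀ W → Extensional (λ x → φ x W)) →
  (Y ≡ [] → ∀ W → W ↭ B₀ ++ u ∷ v ∷ [] → Invariant i (λ x → φ x W)) →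
  (∀ P a b V → length P ≡ suc (length B₀) → P ++ a ∷ b ∷ V ↭ B₀ ++ u ∷ v ∷ Y → a ℕ.< b →
    Rel i (λ x → φ x (P ++ a ∷ b ∷ V)) (λ x → φ x (P ++ b ∷ a ∷ V))) →
  Rel i (λ x → col k x (B₀ ++ u ∷ v ∷ Y) (φ x)) (λ x → col k x (B₀ ++ v ∷ u ∷ Y) (φ x))
col-Rel-ascent []       i k u v Y refl u<v uniq ext inv rel =
  col-Rel-ascent₀ i u v Y u<v uniq ext inv (λ c a b V → rel (c ∷ []) a b V refl)
col-Rel-ascent (d ∷ B₀) i k u v Y {φ} i≡ u<v (_ ∷ uniq) ext inv rel =
  col-Rel-ascent B₀ i (suc k) u v Y (trans i≡ (sym (ℕₚ.+-suc (length B₀) k))) u<v uniq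
    (λ W → op-Extensional (λ x → x k) (λ x x′ h → h k) φ d W ext)
    (λ e W p → invariant λ x ne μ → trans
       (op-cong (swapEnv i x k) d W (λ V q μ → Invariant.under-swap (inv e V (↭-trans q (prep d p))) x ne μ) μ)
       (cong (λ a → op a d (φ x) W μ) (swapEnv-< i x k k<i)))
    rel′
  where
  k<i : k ℕ.< i
  k<i = subst (k ℕ.<_) (sym i≡) (s≤s (ℕₚ.m≤n+m k (length B₀)))
  rel′ : ∀ P a b V → length P ≡ suc (length B₀) → P ++ a ∷ b ∷ V ↭ B₀ ++ u ∷ v ∷ Y → a ℕ.< b →
    Rel i (λ x → op (x k) d (φ x) (P ++ a ∷ b ∷ V)) (λ x → op (x k) d (φ x) (P ++ b ∷ a ∷ V))
  rel′ (e ∷ P) a b V l p a<b = op-Rel (λ x → x k) (λ x → swapEnv-< i x k k<i) φ φ d e (P ++ a ∷ b ∷ V) (P ++ b ∷ a ∷ V)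
    (rel (d ∷ e ∷ P) a b V (cong suc l) (prep d p) a<b)
    (rel (e ∷ d ∷ P) a b V (cong suc l) (↭-trans (swap e d ↭-refl) (prep d p)) a<b)

prodTo-swapEnv-≤ : ∀ i n x → n ℕ.≤ i → prodTo n (swapEnv i x) ≡ prodTo n x
prodTo-swapEnv-≤ i n x n≤i = prodTo-cong n (λ j j<n → swapEnv-< i x j (ℕₚ.<-≤-trans j<n n≤i))

prodTo-swapEnv-> : ∀ i n x → prodTo (suc (suc i) ℕ.+ n) (swapEnv i x) ≡ prodTo (suc (suc i) ℕ.+ n) x
prodTo-swapEnv-> i zero x rewrite ℕₚ.+-identityʳ i = begin
  prodTo i (swapEnv i x) * swapEnv i x i * swapEnv i x (suc i)
    ≡⟨ cong₂ _*_ (cong₂ _*_ (prodTo-swapEnv-≤ i i x ℕₚ.≤-refl) (swapEnv-left i x)) (swapEnv-right i x) ⟩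
  prodTo i x * x (suc i) * x i ≡⟨ swap-factors (prodTo i x) (x (suc i)) (x i) ⟩
  prodTo i x * x i * x (suc i) ∎
  where
  open ≡-Reasoning
  swap-factors : ∀ a b c → a * b * c ≡ a * c * b
  swap-factors = solve-∀
prodTo-swapEnv-> i (suc n) x rewrite ℕₚ.+-suc i n =
  cong₂ _*_ (prodTo-swapEnv-> i n x) (swapEnv-> i x (suc (suc (i ℕ.+ n))) (s≤s (s≤s (ℕₚ.m≤m+n i n))))

splitOn-nothing : ∀ m w → splitOn m w ≡ nothing → All (_≢ m) w
splitOn-nothing m []      eq = []
splitOn-nothing m (a ∷ w) eq with a ℕ.≟ m
... | no a≢m with splitOn m w in eq′
...   | nothing = a≢m ∷ splitOn-nothing m w eq′

splitOn-just-∉ : ∀ m w {A B} → splitOn m w ≡ just (A , B) → All (_≢ m) A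
splitOn-just-∉ m (a ∷ w) eq with a ℕ.≟ m
splitOn-just-∉ m (a ∷ w) refl | yes _ = []
splitOn-just-∉ m (a ∷ w) eq   | no a≢m with splitOn m w in eq′
splitOn-just-∉ m (a ∷ w) refl | no a≢m | just _ = a≢m ∷ splitOn-just-∉ m w eq′

splitOn-∉ : ∀ {m} w → All (_≢ m) w → splitOn m w ≡ nothing
splitOn-∉ []      []         = refl
splitOn-∉ {m} (a ∷ w) (a≢m ∷ h) with a ℕ.≟ m
... | yes e = ⊥-elim (a≢m e)
... | no  _ rewrite splitOn-∉ w h = refl

splitOn-++ : ∀ {m} A B → All (_≢ m) A → splitOn m (A ++ m ∷ B) ≡ just (A , B)
splitOn-++ {m} [] B [] with m ℕ.≟ m
... | yes _ = refl
... | no ne = ⊥-elim (ne refl)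
splitOn-++ {m} (a ∷ A) B (a≢m ∷ h) with a ℕ.≟ m
... | yes e = ⊥-elim (a≢m e)
... | no  _ rewrite splitOn-++ A B h = refl

g-skip : ∀ f m w → All (_≢ m) w → ∀ x μ → g (suc f) m w x μ ≡ g f (suc m) w x μ
g-skip f m w h x μ = cong (λ s → removeMin f m s w x μ) (splitOn-∉ w h)

g-remove : ∀ f m A B → All (_≢ m) A → ∀ x μ → g (suc f) m (A ++ m ∷ B) x μ
  ≡ prodTo (length A) x * col (suc (length A)) x B (λ W → g f (suc m) (A ++ W) x) μ
g-remove f m A B h x μ = cong (λ s → removeMin f m s (A ++ m ∷ B) x μ) (splitOn-++ A B h)

record Valid (f m : ℕ) (w : List ℕ) : Set where
  constructor valid
  field
    unique : Unique w
    bounds : All (λ a → m ℕ.≤ a × a ℕ.< m ℕ.+ f) w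

Valid-resp-↭ : ∀ {f m v w} → v ↭ w → Valid f m v → Valid f m w
Valid-resp-↭ p (valid u b) = valid (Unique-resp-↭ p u) (All-resp-↭ p b)

Valid-skip : ∀ {f m w} → All (_≢ m) w → Valid (suc f) m w → Valid f (suc m) w
Valid-skip {f} {m} ne (valid u b) = valid u (All.zipWith
  (λ { {a} (a≢m , m≤a , a<) → ℕₚ.≤∧≢⇒< m≤a (a≢m ∘ sym) , subst (a ℕ.<_) (ℕₚ.+-suc m f) a< }) (ne , b))

Valid-remove : ∀ {f m} A {B W} → W ↭ B → Valid (suc f) m (A ++ m ∷ B) → Valid f (suc m) (A ++ W)
Valid-remove {f} {m} A {B} {W} p V with Valid-resp-↭ (shift m A B) V
... | valid (ne ∷ u) (_ ∷ b) = Valid-resp-↭ (++⁺ˡ A (↭-sym p)) (Valid-skip (All.map (λ e e′ → e (sym e′)) ne) (valid u b))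

g-Extensional : ∀ f m w → Extensional (g f m w)
g-Extensional f m w = extensional λ x x′ h μ → g-cong f m w (λ j _ → h j) μ

-- All ascents are treated at once, because removing `m` from one ascent calls for the relation at
-- ascents `a b` of many outcomes. The cases are the positions of `m`: left of the pair, at `u`,
-- absent, or right of the pair, where both variables enter the prefactor symmetrically.
g-Rel : ∀ f m X u v Y → Valid f m (X ++ u ∷ v ∷ Y) → u ℕ.< v →
  Rel (length X) (g f m (X ++ u ∷ v ∷ Y)) (g f m (X ++ v ∷ u ∷ Y))
g-Rel zero m X u v Y (valid _ b) u<v with Allₚ.++⁻ʳ X b
... | (m≤u , u<m) ∷ _ = ⊥-elim (ℕₚ.≤⇒≯ m≤u (subst (u ℕ.<_) (ℕₚ.+-identityʳ m) u<m))
g-Rel (suc f) m X u v Y V u<v with splitOn m X in eqX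
... | just (A , B₀) rewrite splitOn-just m X eqX = inB (splitOn-just-∉ m X eqX)
  where
  i = length (A ++ m ∷ B₀)
  i≡ : i ≡ length B₀ ℕ.+ suc (length A)
  i≡ = trans (length-++ A) (trans (ℕₚ.+-suc (length A) (length B₀))
         (trans (cong suc (ℕₚ.+-comm (length A) (length B₀))) (sym (ℕₚ.+-suc (length B₀) (length A)))))
  V′ : Valid (suc f) m (A ++ m ∷ B₀ ++ u ∷ v ∷ Y)
  V′ = subst (Valid (suc f) m) (++-assoc A (m ∷ B₀) (u ∷ v ∷ Y)) V
  φ : Env → List ℕ → Val
  φ x W = g f (suc m) (A ++ W) x
  inv : Y ≡ [] → ∀ W → W ↭ B₀ ++ u ∷ v ∷ [] → Invariant i (λ x → φ x W)
  inv refl W p = invariant λ x ne → g-cong f (suc m) (A ++ W) (λ j lt → swapEnv-< i x j (bound lt))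
    where
    len : length (A ++ W) ≡ suc i
    len = trans (length-++ A) (trans (cong (length A ℕ.+_) (trans (↭-length p)
            (trans (length-++ B₀) (ℕₚ.+-comm (length B₀) 2))))
            (trans (ℕₚ.+-suc (length A) (suc (length B₀))) (cong suc (sym (length-++ A)))))
    bound : ∀ {j} → suc j ℕ.< length (A ++ W) → j ℕ.< i
    bound lt with s≤s lt′ ← subst (_ ℕ.<_) len lt = lt′
  relation : ∀ P a b V → length P ≡ suc (length B₀) → P ++ a ∷ b ∷ V ↭ B₀ ++ u ∷ v ∷ Y → a ℕ.< b →
    Rel i (λ x → φ x (P ++ a ∷ b ∷ V)) (λ x → φ x (P ++ b ∷ a ∷ V))
  relation P a b V l p a<b = subst (λ j → Rel j (λ x → φ x (P ++ a ∷ b ∷ V)) (λ x → φ x (P ++ b ∷ a ∷ V)))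
    (trans (length-++ A) (trans (cong (length A ℕ.+_) l) (sym (length-++ A))))
    (Rel-resp (λ x μ → cong (λ w → g f (suc m) w x μ) (sym (++-assoc A P _)))
              (λ x μ → cong (λ w → g f (suc m) w x μ) (sym (++-assoc A P _)))
      (g-Rel f (suc m) (A ++ P) a b V
        (subst (Valid f (suc m)) (sym (++-assoc A P _)) (Valid-remove A p V′)) a<b))
  inB : All (_≢ m) A → Rel i (g (suc f) m ((A ++ m ∷ B₀) ++ u ∷ v ∷ Y)) (g (suc f) m ((A ++ m ∷ B₀) ++ v ∷ u ∷ Y))
  inB h = Rel-resp
    (λ x μ → trans (cong (λ w → g (suc f) m w x μ) (++-assoc A (m ∷ B₀) _)) (g-remove f m A _ h x μ))
    (λ x μ → trans (cong (λ w → g (suc f) m w x μ) (++-assoc A (m ∷ B₀) _)) (g-remove f m A _ h x μ))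
    (Rel-* (prodTo (length A))
      (λ x → prodTo-swapEnv-≤ i (length A) x (subst (length A ℕ.≤_) (sym (length-++ A)) (ℕₚ.m≤m+n (length A) _)))
      (col-Rel-ascent B₀ i (suc (length A)) u v Y i≡ u<v
        (AllPairs.tail (Unique-drop A (Valid.unique V′)))
        (λ W → g-Extensional f (suc m) (A ++ W)) inv relation))
... | nothing with u ℕ.≟ m
...   | yes refl = Rel-resp
    (λ x μ → g-remove f m X (v ∷ Y) X∌m x μ)
    (λ x μ → trans (cong (λ w → g (suc f) m w x μ) (sym (++-assoc X (v ∷ []) (m ∷ Y))))
      (trans (g-remove f m (X ++ v ∷ []) Y (Allₚ.++⁺ X∌m (ℕₚ.>⇒≢ u<v ∷ [])) x μ)
      (trans (cong (λ n → prodTo n x * col (suc n) x Y (λ W → g f (suc m) ((X ++ v ∷ []) ++ W) x) μ)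
               (trans (length-++ X) (ℕₚ.+-comm (length X) 1)))
      (trans (cong (prodTo (length X) x * x (length X) *_)
               (col-cong (suc (suc (length X))) x x Y (λ _ _ _ → refl)
                 (λ W _ μ → cong (λ w → g f (suc m) w x μ) (++-assoc X (v ∷ []) W)) μ))
             (ℤₚ.*-assoc (prodTo (length X) x) (x (length X)) _)))))
    (Rel-* (prodTo (length X)) (λ x → prodTo-swapEnv-≤ (length X) (length X) x ℕₚ.≤-refl)
      (col-Rel-ascent-at-min (length X) v Y (AllPairs.tail (Unique-drop X (Valid.unique V)))
        (λ W → g-Extensional f (suc m) (X ++ W))
        (λ _ → invariant λ x _ → g-cong f (suc m) (X ++ v ∷ []) (λ j lt → swapEnv-< (length X) x j (bound lt)))
        (λ a b W p a<b → g-Rel f (suc m) X a b W (Valid-remove X p V) a<b)))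
    where
    X∌m : All (_≢ m) X
    X∌m = splitOn-nothing m X eqX
    bound : ∀ {j} → suc j ℕ.< length (X ++ v ∷ []) → j ℕ.< length X
    bound lt with s≤s lt′ ← subst (_ ℕ.<_) (trans (length-++ X) (ℕₚ.+-comm (length X) 1)) lt = lt′
...   | no u≢m with splitOn m Y in eqY
...     | nothing = Rel-resp
    (λ x μ → g-skip f m (X ++ u ∷ v ∷ Y) (Allₚ.++⁺ X∌m (u≢m ∷ v≢m ∷ Y∌m)) x μ)
    (λ x μ → g-skip f m (X ++ v ∷ u ∷ Y) (Allₚ.++⁺ X∌m (v≢m ∷ u≢m ∷ Y∌m)) x μ)
    (g-Rel f (suc m) X u v Y (Valid-skip (Allₚ.++⁺ X∌m (u≢m ∷ v≢m ∷ Y∌m)) V) u<v)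
    where
    X∌m : All (_≢ m) X
    X∌m = splitOn-nothing m X eqX
    Y∌m : All (_≢ m) Y
    Y∌m = splitOn-nothing m Y eqY
    v≢m : v ≢ m
    v≢m = ℕₚ.>⇒≢ (ℕₚ.≤-<-trans (proj₁ (All.head (Allₚ.++⁻ʳ X (Valid.bounds V)))) u<v)
...     | just (A , B) rewrite splitOn-just m Y eqY = inA (splitOn-just-∉ m Y eqY)
  where
  i = length X
  X∌m : All (_≢ m) X
  X∌m = splitOn-nothing m X eqX
  v≢m : v ≢ m
  v≢m = ℕₚ.>⇒≢ (ℕₚ.≤-<-trans (proj₁ (All.head (Allₚ.++⁻ʳ X (Valid.bounds V)))) u<v)
  len : ∀ a b → length (X ++ a ∷ b ∷ A) ≡ suc (suc i) ℕ.+ length A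
  len a b = trans (length-++ X) (trans (ℕₚ.+-suc i (suc (length A))) (cong suc (ℕₚ.+-suc i (length A))))
  unfold : ∀ a b → a ≢ m → b ≢ m → All (_≢ m) A → ∀ x μ → g (suc f) m (X ++ a ∷ b ∷ A ++ m ∷ B) x μ
    ≡ prodTo (suc (suc i) ℕ.+ length A) x
      * col (suc (suc (suc i) ℕ.+ length A)) x B (λ W → g f (suc m) (X ++ a ∷ b ∷ A ++ W) x) μ
  unfold a b a≢m b≢m h x μ =
    trans (cong (λ w → g (suc f) m w x μ) (sym (++-assoc X (a ∷ b ∷ A) (m ∷ B))))
    (trans (g-remove f m (X ++ a ∷ b ∷ A) B (Allₚ.++⁺ X∌m (a≢m ∷ b≢m ∷ h)) x μ)
    (trans (cong (λ n → prodTo n x * col (suc n) x B (λ W → g f (suc m) ((X ++ a ∷ b ∷ A) ++ W) x) μ) (len a b))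
      (cong (prodTo (suc (suc i) ℕ.+ length A) x *_)
        (col-cong (suc (suc (suc i) ℕ.+ length A)) x x B (λ _ _ _ → refl)
          (λ W _ μ → cong (λ w → g f (suc m) w x μ) (++-assoc X (a ∷ b ∷ A) W)) μ))))
  V′ : Valid (suc f) m ((X ++ u ∷ v ∷ A) ++ m ∷ B)
  V′ = subst (Valid (suc f) m) (sym (++-assoc X (u ∷ v ∷ A) (m ∷ B))) V
  inA : All (_≢ m) A → Rel i (g (suc f) m (X ++ u ∷ v ∷ A ++ m ∷ B)) (g (suc f) m (X ++ v ∷ u ∷ A ++ m ∷ B))
  inA h = Rel-resp (unfold u v u≢m v≢m h) (unfold v u v≢m u≢m h)
    (Rel-* (prodTo (suc (suc i) ℕ.+ length A)) (prodTo-swapEnv-> i (length A))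
      (col-Rel i (suc (suc (suc i) ℕ.+ length A)) B (s≤s (s≤s (ℕₚ.m≤n⇒m≤1+n (ℕₚ.m≤m+n i (length A)))))
        (λ W p → g-Rel f (suc m) X u v (A ++ W)
          (subst (Valid f (suc m)) (++-assoc X (u ∷ v ∷ A) W) (Valid-remove (X ++ u ∷ v ∷ A) p V′)) u<v)))

-- The column recursion computes 𝔊_w

data Ascent : ℕ → List ℕ → Set where
  ascent : ∀ X {u v} Y → u ℕ.< v → Ascent (length X) (X ++ u ∷ v ∷ Y)

firstAscent-just : ∀ w {i} → firstAscent w ≡ just i → Ascent i w
firstAscent-just (a ∷ b ∷ r) eq with a <ᵇ b in a<b
firstAscent-just (a ∷ b ∷ r) refl | true = ascent [] r (<ᵇ-true⁻¹ a<b)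
... | false with firstAscent (b ∷ r) in eq′
firstAscent-just (a ∷ b ∷ r) refl | false | just i with b ∷ r | firstAscent-just (b ∷ r) eq′
... | _ | ascent X Y u<v = ascent (a ∷ X) Y u<v

Descending : List ℕ → Set
Descending w = ∀ X u v Y → w ≡ X ++ u ∷ v ∷ Y → v ℕ.≤ u

firstAscent-nothing : ∀ w → firstAscent w ≡ nothing → Descending w
firstAscent-nothing (a ∷ b ∷ r) eq X u v Y e with a <ᵇ b in a<b
... | false with firstAscent (b ∷ r) in eq′
firstAscent-nothing (a ∷ b ∷ r) eq [] .a .b .r refl | false | nothing = <ᵇ-false⁻¹ a<b
firstAscent-nothing (a ∷ b ∷ r) eq (_ ∷ X) u v Y e | false | nothing =
  firstAscent-nothing (b ∷ r) eq′ X u v Y (∷-injectiveʳ e)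
firstAscent-nothing [] eq [] u v Y ()
firstAscent-nothing [] eq (_ ∷ _) u v Y ()
firstAscent-nothing (a ∷ []) eq (_ ∷ []) u v Y ()
firstAscent-nothing (a ∷ []) eq (_ ∷ _ ∷ _) u v Y ()

swapAt-++ : ∀ X u v Y → swapAt (length X) (X ++ u ∷ v ∷ Y) ≡ X ++ v ∷ u ∷ Y
swapAt-++ []      u v Y = refl
swapAt-++ (a ∷ X) u v Y = cong (a ∷_) (swapAt-++ X u v Y)

swapAt-↭ : ∀ i w → swapAt i w ↭ w
swapAt-↭ zero    []          = ↭-refl
swapAt-↭ zero    (a ∷ [])    = ↭-refl
swapAt-↭ zero    (a ∷ b ∷ w) = swap b a ↭-refl
swapAt-↭ (suc i) []          = ↭-refl
swapAt-↭ (suc i) (a ∷ w)     = prep a (swapAt-↭ i w)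

countGreater : ℕ → List ℕ → ℕ
countGreater a []      = 0
countGreater a (b ∷ w) = (if a <ᵇ b then 1 else 0) ℕ.+ countGreater a w

-- The number of non-inversions, which is the number of steps `grothFuel` has still to make.
ascendingPairs : List ℕ → ℕ
ascendingPairs []      = 0
ascendingPairs (a ∷ w) = countGreater a w ℕ.+ ascendingPairs w

countGreater-swap : ∀ a X u v Y → countGreater a (X ++ u ∷ v ∷ Y) ≡ countGreater a (X ++ v ∷ u ∷ Y)
countGreater-swap a (b ∷ X) u v Y = cong (_ ℕ.+_) (countGreater-swap a X u v Y)
countGreater-swap a [] u v Y = trans (sym (ℕₚ.+-assoc p q (countGreater a Y)))
  (trans (cong (ℕ._+ countGreater a Y) (ℕₚ.+-comm p q)) (ℕₚ.+-assoc q p (countGreater a Y)))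
  where
  p = if a <ᵇ u then 1 else 0
  q = if a <ᵇ v then 1 else 0

ascendingPairs-swap : ∀ X u v Y → u ℕ.< v →
  ascendingPairs (X ++ u ∷ v ∷ Y) ≡ suc (ascendingPairs (X ++ v ∷ u ∷ Y))
ascendingPairs-swap (a ∷ X) u v Y u<v = trans
  (cong₂ ℕ._+_ (countGreater-swap a X u v Y) (ascendingPairs-swap X u v Y u<v)) (ℕₚ.+-suc _ _)
ascendingPairs-swap [] u v Y u<v rewrite <ᵇ-true u<v | <ᵇ-false (ℕₚ.<⇒≤ u<v) = cong suc (trans (sym (ℕₚ.+-assoc (countGreater u Y) _ _))
    (trans (cong (ℕ._+ ascendingPairs Y) (ℕₚ.+-comm (countGreater u Y) _)) (ℕₚ.+-assoc (countGreater v Y) _ _)))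

countGreater-≤ : ∀ a w → countGreater a w ℕ.≤ length w
countGreater-≤ a []      = z≤n
countGreater-≤ a (b ∷ w) with a <ᵇ b
... | true  = s≤s (countGreater-≤ a w)
... | false = ℕₚ.m≤n⇒m≤1+n (countGreater-≤ a w)

ascendingPairs-≤ : ∀ w → ascendingPairs w ℕ.≤ length w ℕ.* length w
ascendingPairs-≤ []      = z≤n
ascendingPairs-≤ (a ∷ w) = ℕₚ.≤-trans
  (ℕₚ.+-mono-≤ (countGreater-≤ a w) (ℕₚ.≤-trans (ascendingPairs-≤ w)
    (ℕₚ.*-monoʳ-≤ (length w) (ℕₚ.n≤1+n (length w)))))
  (ℕₚ.n≤1+n _)

prodTo-suc : ∀ n x → prodTo (suc n) x ≡ x 0 * prodTo n (x ∘ suc)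
prodTo-suc zero    x = ℤₚ.*-comm (+ 1) (x 0)
prodTo-suc (suc n) x = trans (cong (_* x (suc n)) (prodTo-suc n x)) (ℤₚ.*-assoc (x 0) _ _)

monomial-downFrom : ∀ n x → monomial (downFrom (suc n)) x ≡ prodTo n x * monomial (downFrom n) x
monomial-downFrom zero    x = refl
monomial-downFrom (suc n) x = trans (cong (x 0 * x 0 ^ n *_) (monomial-downFrom n (x ∘ suc)))
  (trans (regroup (x 0) (x 0 ^ n) (prodTo n (x ∘ suc)) (monomial (downFrom n) (x ∘ suc)))
         (cong (_* (x 0 ^ n * monomial (downFrom n) (x ∘ suc))) (sym (prodTo-suc n x))))
  where
  regroup : ∀ a b c d → a * b * (c * d) ≡ (a * c) * (b * d)
  regroup = solve-∀

-- The minimum of a descending word stands last, so the column expansion is trivial and each removal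
-- contributes one full row product of the staircase.
g-descending : ∀ F m w → Valid F m w → Descending w → ∀ x μ →
  monomial (downFrom (length w)) x * μ 0 ≡ g F m w x μ
g-descending zero m []      V desc x μ = ℤₚ.*-identityˡ (μ 0)
g-descending zero m (a ∷ w) (valid _ ((m≤a , a<m) ∷ _)) desc x μ =
  ⊥-elim (ℕₚ.≤⇒≯ m≤a (subst (a ℕ.<_) (ℕₚ.+-identityʳ m) a<m))
g-descending (suc F) m w V desc x μ with splitOn m w in eq
... | nothing = g-descending F (suc m) w (Valid-skip (splitOn-nothing m w eq) V) desc x μ
... | just (A , b ∷ B) rewrite splitOn-just m w eq =
  ⊥-elim (All.head (AllPairs.head (Unique-drop A (Valid.unique V)))
    (ℕₚ.≤-antisym (proj₁ (All.head (All.tail (Allₚ.++⁻ʳ A (Valid.bounds V))))) (desc A m b B refl)))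
g-descending (suc F) m w V desc x μ | just (A , []) rewrite splitOn-just m w eq = begin
  monomial (downFrom (length (A ++ m ∷ []))) x * μ 0
    ≡⟨ cong (λ n → monomial (downFrom n) x * μ 0) (trans (length-++ A) (ℕₚ.+-comm (length A) 1)) ⟩
  monomial (downFrom (suc (length A))) x * μ 0       ≡⟨ cong (_* μ 0) (monomial-downFrom (length A) x) ⟩
  prodTo (length A) x * monomial (downFrom (length A)) x * μ 0 ≡⟨ ℤₚ.*-assoc (prodTo (length A) x) _ _ ⟩
  prodTo (length A) x * (monomial (downFrom (length A)) x * μ 0)
    ≡⟨ cong (λ w → prodTo (length A) x * (monomial (downFrom (length w)) x * μ 0)) (sym (++-identityʳ A)) ⟩
  prodTo (length A) x * (monomial (downFrom (length (A ++ []))) x * μ 0)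
    ≡⟨ cong (prodTo (length A) x *_) (g-descending F (suc m) (A ++ []) (Valid-remove A ↭-refl V) desc′ x μ) ⟩
  prodTo (length A) x * g F (suc m) (A ++ []) x μ ∎
  where
  open ≡-Reasoning
  desc′ : Descending (A ++ [])
  desc′ X u v Y e = desc X u v (Y ++ m ∷ []) (trans (cong (_++ m ∷ []) (trans (sym (++-identityʳ A)) e)) (++-assoc X (u ∷ v ∷ Y) _))

Long-grothFuel : ∀ f w → All (Long (length w)) (grothFuel f w)
Long-grothFuel f w with firstAscent w
Long-grothFuel f       w | nothing = length-downFrom (length w) ∷ []
Long-grothFuel zero    w | just i  = []
Long-grothFuel (suc f) w | just i  = Long-piOp i (grothFuel f (swapAt i w))
  (subst (λ n → All (Long n) (grothFuel f (swapAt i w))) (↭-length (swapAt-↭ i w)) (Long-grothFuel f (swapAt i w)))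

-- All coordinates must differ, not just two neighbours: the recursion meets various `i` and also
-- evaluates at swapped points.
eval-grothFuel : ∀ f w F m → Valid F m w → ascendingPairs w ℕ.≤ f → ∀ x → Distinct x → ∀ μ →
  eval (grothFuel f w) x μ ≡ g F m w x μ
eval-grothFuel f w F m V bound x d μ with firstAscent w in eq
eval-grothFuel f w F m V bound x d μ | nothing =
  trans (ℤₚ.+-identityʳ _) (trans (ℤₚ.*-identityˡ _) (g-descending F m w V (firstAscent-nothing w eq) x μ))
eval-grothFuel f w F m V bound x d μ | just i with firstAscent-just w eq
eval-grothFuel zero .(X ++ u ∷ v ∷ Y) F m V bound x d μ | just .(length X) | ascent X {u} {v} Y u<v =
  ⊥-elim (ℕₚ.n≮0 (subst (ℕ._≤ 0) (ascendingPairs-swap X u v Y u<v) bound))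
eval-grothFuel (suc f) .(X ++ u ∷ v ∷ Y) F m V bound x d μ | just .(length X) | ascent X {u} {v} Y u<v
  rewrite swapAt-++ X u v Y =
  cancel-difference _ _ x≢ (trans (eval-piOp i G x μ i<n L)
    (trans (cong₂ _-_ (cong₂ (λ a b → a + x (suc i) * b) (IH x d μ) (IH x d (S μ)))
                      (cong₂ (λ a b → a + x i * b) (IH sx sd μ) (IH sx sd (S μ))))
      (sym (Rel.at (g-Rel F m X u v Y V u<v) x x≢ μ))))
  where
  i = length X
  G = grothFuel f (X ++ v ∷ u ∷ Y)
  sx = swapEnv i x
  sd = Distinct-swapEnv i x d
  x≢ : x i ≢ x (suc i)
  x≢ e = ℕₚ.1+n≢n (sym (d _ _ e))
  w↭ : X ++ u ∷ v ∷ Y ↭ X ++ v ∷ u ∷ Y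
  w↭ = ++⁺ˡ X (swap u v ↭-refl)
  IH : ∀ x → Distinct x → ∀ μ → eval G x μ ≡ g F m (X ++ v ∷ u ∷ Y) x μ
  IH = eval-grothFuel f _ F m (Valid-resp-↭ w↭ V)
         (ℕₚ.≤-pred (subst (ℕ._≤ suc f) (ascendingPairs-swap X u v Y u<v) bound))
  L : All (Long (length (X ++ v ∷ u ∷ Y))) G
  L = Long-grothFuel f (X ++ v ∷ u ∷ Y)
  i<n : suc i ℕ.< length (X ++ v ∷ u ∷ Y)
  i<n = subst (suc i ℕ.<_) (sym (length-++ X)) (subst (ℕ._≤ i ℕ.+ suc (suc (length Y))) (ℕₚ.+-comm i 2)
          (ℕₚ.+-monoʳ-≤ i (s≤s (s≤s z≤n))))

-- Congruences, for passing from distinct coordinates to (1, 1, ...)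

infix 4 _≈_[mod_]

record _≈_[mod_] (a b t : ℤ) : Set where
  constructor modulo
  field
    quotient : ℤ
    equation : a ≡ b + t * quotient

≈-refl : ∀ {a t} → a ≈ a [mod t ]
≈-refl {a} {t} = modulo (+ 0) (sym (trans (cong (λ z → a + z) (ℤₚ.*-zeroʳ t)) (ℤₚ.+-identityʳ a)))

≈-+ : ∀ {a b c d t} → a ≈ b [mod t ] → c ≈ d [mod t ] → a + c ≈ b + d [mod t ]
≈-+ {b = b} {d = d} {t} (modulo p refl) (modulo q refl) = modulo (p + q) (lemma b d t p q)
  where
  lemma : ∀ b d t p q → (b + t * p) + (d + t * q) ≡ (b + d) + t * (p + q)
  lemma = solve-∀

≈-* : ∀ {a b c d t} → a ≈ b [mod t ] → c ≈ d [mod t ] → a * c ≈ b * d [mod t ]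
≈-* {b = b} {d = d} {t} (modulo p refl) (modulo q refl) = modulo (p * d + b * q + t * (p * q)) (lemma b d t p q)
  where
  lemma : ∀ b d t p q → (b + t * p) * (d + t * q) ≡ (b * d) + t * (p * d + b * q + t * (p * q))
  lemma = solve-∀

≈-^ : ∀ {a b t} n → a ≈ b [mod t ] → a ^ n ≈ b ^ n [mod t ]
≈-^ zero    e = ≈-refl
≈-^ (suc n) e = ≈-* e (≈-^ n e)

≈-through : ∀ {a b c t} → a ≈ b [mod t ] → a ≈ c [mod t ] → b ≈ c [mod t ]
≈-through {b = b} {c} {t} (modulo p refl) (modulo q e) = modulo (q - p) (trans (lemma₁ b t p)
  (trans (cong (_- t * p) e) (lemma₂ c t p q)))
  where
  lemma₁ : ∀ b t p → b ≡ (b + t * p) - t * p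
  lemma₁ = solve-∀
  lemma₂ : ∀ c t p q → (c + t * q) - t * p ≡ c + t * (q - p)
  lemma₂ = solve-∀

-- The modulus |a - b| + 1 divides a - b but exceeds its absolute value.
≈-all⇒≡ : ∀ {a b} → (∀ n → a ≈ b [mod + suc n ]) → a ≡ b
≈-all⇒≡ {a} {b} h with h ∣ a - b ∣
... | modulo q e = ℤₚ.i-j≡0⇒i≡j a b (ℤₚ.∣i∣≡0⇒i≡0 (small ∣ a - b ∣ ∣ q ∣ abs))
  where
  cancel : ∀ b z → (b + z) - b ≡ z
  cancel = solve-∀
  abs : ∣ a - b ∣ ≡ suc ∣ a - b ∣ ℕ.* ∣ q ∣
  abs = trans (cong ∣_∣ (trans (cong (_- b) e) (cancel b _))) (ℤₚ.abs-* (+ suc ∣ a - b ∣) q)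
  small : ∀ n k → n ≡ suc n ℕ.* k → n ≡ 0
  small n zero    e = trans e (ℕₚ.*-zeroʳ (suc n))
  small n (suc k) e = ⊥-elim (ℕₚ.<-irrefl e (ℕₚ.m≤m*n (suc n) (suc k)))

module _ {t : ℤ} where

  _≋_ : Env → Env → Set
  x ≋ y = ∀ j → x j ≈ y j [mod t ]

  monomial-≈ : ∀ es {x y} → x ≋ y → monomial es x ≈ monomial es y [mod t ]
  monomial-≈ []       h = ≈-refl
  monomial-≈ (e ∷ es) h = ≈-* (≈-^ e (h 0)) (monomial-≈ es (h ∘ suc))

  eval-≈ : ∀ f {x y} → x ≋ y → ∀ μ → eval f x μ ≈ eval f y μ [mod t ]
  eval-≈ []                   h μ = ≈-refl
  eval-≈ (mkTerm es b c ∷ f) h μ = ≈-+ (≈-* (≈-refl {c}) (≈-* (monomial-≈ es h) ≈-refl)) (eval-≈ f h μ)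

  op-≈ : ∀ {a a′} b {ψ ψ′ : List ℕ → Val} W → a ≈ a′ [mod t ] → (∀ V μ → ψ V μ ≈ ψ′ V μ [mod t ]) →
    ∀ μ → op a b ψ W μ ≈ op a′ b ψ′ W μ [mod t ]
  op-≈ b []      ha h μ = h _ μ
  op-≈ b (e ∷ V) ha h μ with e <ᵇ b
  ... | true  = ≈-+ (≈-+ (h _ μ) (≈-* ha (h _ (S μ)))) (≈-* ha (h _ μ))
  ... | false = h _ μ

  col-≈ : ∀ k B {x y} {ψ ψ′ : List ℕ → Val} → x ≋ y → (∀ V μ → ψ V μ ≈ ψ′ V μ [mod t ]) →
    ∀ μ → col k x B ψ μ ≈ col k y B ψ′ μ [mod t ]
  col-≈ k []      hx h = h []
  col-≈ k (b ∷ B) hx h = col-≈ (suc k) B hx (λ V μ → op-≈ b V (hx k) h μ)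

  prodTo-≈ : ∀ n {x y} → x ≋ y → prodTo n x ≈ prodTo n y [mod t ]
  prodTo-≈ zero    h = ≈-refl
  prodTo-≈ (suc n) h = ≈-* (prodTo-≈ n h) (h n)

  g-≈ : ∀ F m w {x y} → x ≋ y → ∀ μ → g F m w x μ ≈ g F m w y μ [mod t ]
  g-≈ zero    m w h μ = ≈-refl
  g-≈ (suc F) m w h μ with splitOn m w
  ... | nothing      = g-≈ F (suc m) w h μ
  ... | just (A , B) = ≈-* (prodTo-≈ (length A) h)
                           (col-≈ (suc (length A)) B h (λ W → g-≈ F (suc m) (A ++ W) h) μ)

-- Both sides are polynomials in x that agree at the points (1 + t j)_j for every t > 0;
-- these points are congruent to (1, 1, …) modulo t.
eval-grothFuel-one : ∀ f w F m → Valid F m w → ascendingPairs w ℕ.≤ f → ∀ μ →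
  eval (grothFuel f w) one μ ≡ g F m w one μ
eval-grothFuel-one f w F m V bound μ = ≈-all⇒≡ λ n → ≈-through (eval-≈ (grothFuel f w) (near n) μ)
  (subst (_≈ g F m w one μ [mod + suc n ]) (sym (eval-grothFuel f w F m V bound (point n) (distinct n) μ))
    (g-≈ F m w (near n) μ))
  where
  point : ℕ → Env
  point n j = + 1 + + suc n * + j
  near : ∀ n j → point n j ≈ + 1 [mod + suc n ]
  near n j = modulo (+ j) refl
  distinct : ∀ n → Distinct (point n)
  distinct n j k e = ℤₚ.+-injective (ℤₚ.*-cancelˡ-≡ (+ suc n) (+ j) (+ k) (∙-cancelˡ ℤₚ.+-0-abelianGroup (+ 1) _ _ e))

-- Coefficients of Υ and standardisation

δ : ℕ → Functional
δ k d = if d ℕ.≡ᵇ k then + 1 else + 0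

monomial-one : ∀ es → monomial es one ≡ + 1
monomial-one []       = refl
monomial-one (e ∷ es) = cong₂ _*_ (ℤₚ.^-zeroˡ e) (monomial-one es)

coeffAtOnes-eval : ∀ f k → coeffAtOnes f k ≡ eval f one (δ k)
coeffAtOnes-eval []                   k = refl
coeffAtOnes-eval (mkTerm es b c ∷ f) k = cong₂ _+_ (term (b ℕ.≡ᵇ k)) (coeffAtOnes-eval f k)
  where
  term : ∀ z → (if z then c else + 0) ≡ c * (monomial es one * (if z then + 1 else + 0))
  term true  = trans (sym (ℤₚ.*-identityʳ c)) (cong (λ m → c * (m * + 1)) (sym (monomial-one es)))
  term false = trans (sym (ℤₚ.*-zeroʳ c)) (cong (c *_) (sym (ℤₚ.*-zeroʳ (monomial es one))))

OrderPreserving : (ℕ → ℕ) → List ℕ → Set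
OrderPreserving h w = ∀ {a b} → a ∈ w → b ∈ w → (h a <ᵇ h b) ≡ (a <ᵇ b)

firstAscent-map : ∀ h w → OrderPreserving h w → firstAscent (map h w) ≡ firstAscent w
firstAscent-map h []          o = refl
firstAscent-map h (a ∷ [])    o = refl
firstAscent-map h (a ∷ b ∷ w) o = cong₂ (λ z i → if z then just 0 else Maybe.map suc i)
  (o (here refl) (there (here refl))) (firstAscent-map h (b ∷ w) (λ p q → o (there p) (there q)))

swapAt-map : ∀ h i w → swapAt i (map h w) ≡ map h (swapAt i w)
swapAt-map h zero    []          = refl
swapAt-map h zero    (a ∷ [])    = refl
swapAt-map h zero    (a ∷ b ∷ w) = refl
swapAt-map h (suc i) []          = refl
swapAt-map h (suc i) (a ∷ w)     = cong (h a ∷_) (swapAt-map h i w)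

-- `grothFuel` sees letters only through comparisons. Standardisation can thus be dropped, and all
-- subwords of `w` keep their original letters, which makes them comparable with each other.
grothFuel-map : ∀ h f w → OrderPreserving h w → grothFuel f (map h w) ≡ grothFuel f w
grothFuel-map h f w o rewrite firstAscent-map h w o with firstAscent w
grothFuel-map h f       w o | nothing = cong (λ n → mkTerm (downFrom n) 0 (+ 1) ∷ []) (length-map h w)
grothFuel-map h zero    w o | just i  = refl
grothFuel-map h (suc f) w o | just i rewrite swapAt-map h i w =
  cong (piOp i) (grothFuel-map h f (swapAt i w)
    (λ p q → o (∈-resp-↭ (swapAt-↭ i w) p) (∈-resp-↭ (swapAt-↭ i w) q)))

countLess-mono : ∀ {a b} w → a ℕ.≤ b → countLess a w ℕ.≤ countLess b w
countLess-mono []      a≤b = z≤n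
countLess-mono {a} {b} (c ∷ w) a≤b with c <ᵇ a in c<a | c <ᵇ b in c<b
... | true  | true  = s≤s (countLess-mono w a≤b)
... | true  | false = ⊥-elim (ℕₚ.≤⇒≯ (<ᵇ-false⁻¹ c<b) (ℕₚ.<-≤-trans (<ᵇ-true⁻¹ c<a) a≤b))
... | false | true  = ℕₚ.m≤n⇒m≤1+n (countLess-mono w a≤b)
... | false | false = countLess-mono w a≤b

countLess-strict : ∀ {a b w} → a ∈ w → a ℕ.< b → countLess a w ℕ.< countLess b w
countLess-strict {a} {b} {.a ∷ w} (here refl) a<b
  rewrite <ᵇ-false (ℕₚ.≤-refl {a}) | <ᵇ-true a<b = s≤s (countLess-mono w (ℕₚ.<⇒≤ a<b))
countLess-strict {a} {b} {c ∷ w} (there p) a<b =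
  ℕₚ.+-mono-≤-< (head (countLess-mono {a} {b} (c ∷ []) (ℕₚ.<⇒≤ a<b))) (countLess-strict p a<b)
  where
  head : ∀ {m n} → m ℕ.+ 0 ℕ.≤ n ℕ.+ 0 → m ℕ.≤ n
  head {m} {n} = subst₂ ℕ._≤_ (ℕₚ.+-identityʳ m) (ℕₚ.+-identityʳ n)

stdz-OrderPreserving : ∀ v → OrderPreserving (λ a → suc (countLess a v)) v
stdz-OrderPreserving v {a} {b} a∈v b∈v with a ℕ.<? b
... | yes a<b = trans (<ᵇ-true (countLess-strict a∈v a<b)) (sym (<ᵇ-true a<b))
... | no  a≮b = trans (<ᵇ-false (countLess-mono v (ℕₚ.≮⇒≥ a≮b))) (sym (<ᵇ-false (ℕₚ.≮⇒≥ a≮b)))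

upsilonCoeff-stdz : ∀ F m v → Valid F m v → ∀ k → upsilonCoeff (stdz v) k ≡ g F m v one (δ k)
upsilonCoeff-stdz F m v V k = begin
  coeffAtOnes (grothFuel (length (stdz v) ℕ.* length (stdz v)) (stdz v)) k
    ≡⟨ cong (λ n → coeffAtOnes (grothFuel (n ℕ.* n) (stdz v)) k) (length-map _ v) ⟩
  coeffAtOnes (grothFuel (length v ℕ.* length v) (stdz v)) k
    ≡⟨ cong (λ G → coeffAtOnes G k) (grothFuel-map _ (length v ℕ.* length v) v (stdz-OrderPreserving v)) ⟩
  coeffAtOnes (grothFuel (length v ℕ.* length v) v) k     ≡⟨ coeffAtOnes-eval (grothFuel (length v ℕ.* length v) v) k ⟩
  eval (grothFuel (length v ℕ.* length v) v) one (δ k)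
    ≡⟨ eval-grothFuel-one _ v F m V (ascendingPairs-≤ v) (δ k) ⟩
  g F m v one (δ k) ∎
  where open ≡-Reasoning

-- Alternating sums over subwords of the column recursion at x = 1

K : List ℕ → (List ℕ → Val) → Val
K []      ψ = ψ []
K (b ∷ B) ψ = K B (op (+ 1) b ψ)

col-one : ∀ k B ψ μ → col k one B ψ μ ≡ K B ψ μ
col-one k []      ψ μ = refl
col-one k (b ∷ B) ψ μ = col-one (suc k) B (op (+ 1) b ψ) μ

K-cong : ∀ B {ψ ψ′} → (∀ W → W ↭ B → ∀ μ → ψ W μ ≡ ψ′ W μ) → ∀ μ → K B ψ μ ≡ K B ψ′ μ
K-cong []      h = h [] ↭-refl
K-cong (b ∷ B) h = K-cong B (λ W p → op-cong (+ 1) b W (λ V q → h V (↭-trans q (prep b p))))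

K-zero : ∀ B μ → K B (λ _ _ → + 0) μ ≡ + 0
K-zero []      μ = refl
K-zero (b ∷ B) μ = trans (K-cong B (λ W _ μ → step W μ) μ) (K-zero B μ)
  where
  step : ∀ W μ → op (+ 1) b (λ _ _ → + 0) W μ ≡ + 0
  step []      μ = refl
  step (e ∷ V) μ with e <ᵇ b
  ... | true  = refl
  ... | false = refl

K-+ : ∀ B ψ ψ′ μ → K B (λ W μ → ψ W μ + ψ′ W μ) μ ≡ K B ψ μ + K B ψ′ μ
K-+ []      ψ ψ′ μ = refl
K-+ (b ∷ B) ψ ψ′ μ = trans (K-cong B (λ W _ μ → step W μ) μ) (K-+ B (op (+ 1) b ψ) (op (+ 1) b ψ′) μ)
  where
  regroup : ∀ p p′ q q′ r r′ → ((p + p′) + + 1 * (q + q′)) + + 1 * (r + r′)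
    ≡ ((p + + 1 * q) + + 1 * r) + ((p′ + + 1 * q′) + + 1 * r′)
  regroup = solve-∀
  step : ∀ W μ → op (+ 1) b (λ W μ → ψ W μ + ψ′ W μ) W μ ≡ op (+ 1) b ψ W μ + op (+ 1) b ψ′ W μ
  step []      μ = refl
  step (e ∷ V) μ with e <ᵇ b
  ... | true  = regroup (ψ (b ∷ e ∷ V) μ) (ψ′ (b ∷ e ∷ V) μ) (ψ (b ∷ e ∷ V) (S μ)) (ψ′ (b ∷ e ∷ V) (S μ))
                        (ψ (e ∷ b ∷ V) μ) (ψ′ (e ∷ b ∷ V) μ)
  ... | false = refl

K-- : ∀ B ψ ψ′ μ → K B (λ W μ → ψ W μ - ψ′ W μ) μ ≡ K B ψ μ - K B ψ′ μ
K-- []      ψ ψ′ μ = refl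
K-- (b ∷ B) ψ ψ′ μ = trans (K-cong B (λ W _ μ → step W μ) μ) (K-- B (op (+ 1) b ψ) (op (+ 1) b ψ′) μ)
  where
  regroup : ∀ p p′ q q′ r r′ → ((p - p′) + + 1 * (q - q′)) + + 1 * (r - r′)
    ≡ ((p + + 1 * q) + + 1 * r) - ((p′ + + 1 * q′) + + 1 * r′)
  regroup = solve-∀
  step : ∀ W μ → op (+ 1) b (λ W μ → ψ W μ - ψ′ W μ) W μ ≡ op (+ 1) b ψ W μ - op (+ 1) b ψ′ W μ
  step []      μ = refl
  step (e ∷ V) μ with e <ᵇ b
  ... | true  = regroup (ψ (b ∷ e ∷ V) μ) (ψ′ (b ∷ e ∷ V) μ) (ψ (b ∷ e ∷ V) (S μ)) (ψ′ (b ∷ e ∷ V) (S μ))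
                        (ψ (e ∷ b ∷ V) μ) (ψ′ (e ∷ b ∷ V) μ)
  ... | false = refl

K-S : ∀ B ψ μ → K B (λ W μ → ψ W (S μ)) μ ≡ K B ψ (S μ)
K-S []      ψ μ = refl
K-S (b ∷ B) ψ μ = trans (K-cong B (λ W _ μ → step W μ) μ) (K-S B (op (+ 1) b ψ) μ)
  where
  step : ∀ W μ → op (+ 1) b (λ W μ → ψ W (S μ)) W μ ≡ op (+ 1) b ψ W (S μ)
  step []      μ = refl
  step (e ∷ V) μ with e <ᵇ b
  ... | true  = refl
  ... | false = refl

-- Selects the outcomes whose first letter could pass in front of `d`, split into head and remainder
-- so that a letter can be put between the two.
gate : ℕ → (ℕ → List ℕ → Val) → List ℕ → Val
gate d χ []      μ = + 0
gate d χ (c ∷ R) μ = if c <ᵇ d then χ c R μ else + 0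

gate-cong : ∀ d {χ χ′} W → (∀ c R → c ℕ.< d → ∀ μ → χ c R μ ≡ χ′ c R μ) → ∀ μ → gate d χ W μ ≡ gate d χ′ W μ
gate-cong d []      h μ = refl
gate-cong d (c ∷ R) h μ with c <ᵇ d in c<d
... | true  = h c R (<ᵇ-true⁻¹ c<d) μ
... | false = refl

gate-< : ∀ {c d} χ R μ → c ℕ.< d → gate d χ (c ∷ R) μ ≡ χ c R μ
gate-< χ R μ c<d rewrite <ᵇ-true c<d = refl

gate-≥ : ∀ {c d} χ R μ → d ℕ.≤ c → gate d χ (c ∷ R) μ ≡ + 0
gate-≥ χ R μ d≤c rewrite <ᵇ-false d≤c = refl

K-gate-- : ∀ d B χ χ′ μ →
  K B (gate d (λ c R μ → χ c R μ - χ′ c R μ)) μ ≡ K B (gate d χ) μ - K B (gate d χ′) μ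
K-gate-- d B χ χ′ μ = trans (K-cong B (λ W _ μ → step W μ) μ) (K-- B (gate d χ) (gate d χ′) μ)
  where
  step : ∀ W μ → gate d (λ c R μ → χ c R μ - χ′ c R μ) W μ ≡ gate d χ W μ - gate d χ′ W μ
  step []      μ = refl
  step (c ∷ R) μ with c <ᵇ d
  ... | true  = refl
  ... | false = refl

-- The weight `1 + β` of a descent is split: its `1` joins the case of a larger next letter in one
-- ungated sum, which contains the trivial outcome, and only genuine events remain gated.
K-∷ : ∀ b B ψ μ → K (b ∷ B) ψ μ ≡ K B (λ W → ψ (b ∷ W)) μ
  + (K B (gate b (λ c R → ψ (b ∷ c ∷ R))) (S μ) + K B (gate b (λ c R → ψ (c ∷ b ∷ R))) μ)
K-∷ b B ψ μ = begin
  K B (op (+ 1) b ψ) μ                                          ≡⟨ K-cong B (λ W _ μ → step W μ) μ ⟩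
  K B (λ W μ → ψ (b ∷ W) μ + (γ W (S μ) + γ′ W μ)) μ
    ≡⟨ K-+ B (λ W → ψ (b ∷ W)) (λ W μ → γ W (S μ) + γ′ W μ) μ ⟩
  K B (λ W → ψ (b ∷ W)) μ + K B (λ W μ → γ W (S μ) + γ′ W μ) μ
    ≡⟨ cong (λ z → K B (λ W → ψ (b ∷ W)) μ + z) (K-+ B (λ W μ → γ W (S μ)) γ′ μ) ⟩
  K B (λ W → ψ (b ∷ W)) μ + (K B (λ W μ → γ W (S μ)) μ + K B γ′ μ)
    ≡⟨ cong (λ z → K B (λ W → ψ (b ∷ W)) μ + (z + K B γ′ μ)) (K-S B γ μ) ⟩
  K B (λ W → ψ (b ∷ W)) μ + (K B γ (S μ) + K B γ′ μ) ∎
  where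
  open ≡-Reasoning
  γ γ′ : List ℕ → Val
  γ  = gate b (λ c R → ψ (b ∷ c ∷ R))
  γ′ = gate b (λ c R → ψ (c ∷ b ∷ R))
  regroup : ∀ p q r → (p + + 1 * q) + + 1 * r ≡ p + (q + r)
  regroup = solve-∀
  step : ∀ W μ → op (+ 1) b ψ W μ ≡ ψ (b ∷ W) μ + (γ W (S μ) + γ′ W μ)
  step []      μ = sym (ℤₚ.+-identityʳ (ψ (b ∷ []) μ))
  step (e ∷ V) μ with e <ᵇ b
  ... | true  = regroup (ψ (b ∷ e ∷ V) μ) (ψ (b ∷ e ∷ V) (S μ)) (ψ (e ∷ b ∷ V) μ)
  ... | false = sym (ℤₚ.+-identityʳ (ψ (b ∷ e ∷ V) μ))

K-gate-< : ∀ {y d} B χ μ → y ℕ.< d → K (y ∷ B) (gate d χ) μ ≡ K B (χ y) μ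
  + (K B (gate y (λ c R → χ y (c ∷ R))) (S μ) + K B (gate y (λ c R → χ c (y ∷ R))) μ)
K-gate-< {y} {d} B χ μ y<d = trans (K-∷ y B (gate d χ) μ) (cong₂ _+_
  (K-cong B (λ W _ μ → gate-< χ W μ y<d) μ)
  (cong₂ _+_ (K-cong B (λ W _ → gate-cong y W (λ c R _ μ → gate-< χ (c ∷ R) μ y<d)) (S μ))
             (K-cong B (λ W _ → gate-cong y W (λ c R c<y μ → gate-< χ (y ∷ R) μ (ℕₚ.<-trans c<y y<d))) μ)))

-- Here `y` is too large to be the head, so it must be passed over. The head `c` satisfies
-- `c < d ≤ y`, hence the condition `c < y` for the exchange is automatic.
K-gate-≥ : ∀ {y d} B χ μ → d ℕ.≤ y → K (y ∷ B) (gate d χ) μ ≡ K B (gate d (λ c R → χ c (y ∷ R))) μ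
K-gate-≥ {y} {d} B χ μ d≤y = trans (K-∷ y B (gate d χ) μ) (trans (cong₂ _+_
    (trans (K-cong B (λ W _ μ → gate-≥ χ W μ d≤y) μ) (K-zero B μ))
    (cong₂ _+_ (trans (K-cong B (λ W _ μ → vanish W μ) (S μ)) (K-zero B (S μ)))
               (K-cong B (λ W _ μ → retract W μ) μ)))
  (trans (ℤₚ.+-identityˡ _) (ℤₚ.+-identityˡ _)))
  where
  vanish : ∀ W μ → gate y (λ c R → gate d χ (y ∷ c ∷ R)) W μ ≡ + 0
  vanish []      μ = refl
  vanish (c ∷ R) μ with c <ᵇ y
  ... | true  = gate-≥ χ (c ∷ R) μ d≤y
  ... | false = refl
  retract : ∀ W μ → gate y (λ c R → gate d χ (c ∷ y ∷ R)) W μ ≡ gate d (λ c R → χ c (y ∷ R)) W μ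
  retract []      μ = refl
  retract (c ∷ R) μ with c ℕ.<? d | c ℕ.<? y
  ... | yes c<d | _ = trans (gate-< (λ c R → gate d χ (c ∷ y ∷ R)) R μ (ℕₚ.<-≤-trans c<d d≤y))
    (trans (gate-< χ (y ∷ R) μ c<d) (sym (gate-< (λ c R → χ c (y ∷ R)) R μ c<d)))
  ... | no c≮d | yes c<y = trans (gate-< (λ c R → gate d χ (c ∷ y ∷ R)) R μ c<y)
    (trans (gate-≥ χ (y ∷ R) μ (ℕₚ.≮⇒≥ c≮d)) (sym (gate-≥ (λ c R → χ c (y ∷ R)) R μ (ℕₚ.≮⇒≥ c≮d))))
  ... | no c≮d | no c≮y = trans (gate-≥ (λ c R → gate d χ (c ∷ y ∷ R)) R μ (ℕₚ.≮⇒≥ c≮y))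
    (sym (gate-≥ (λ c R → χ c (y ∷ R)) R μ (ℕₚ.≮⇒≥ c≮d)))

-- Words some of whose letters are frozen (marked true); alternating sums run
-- over the deletions of free letters only.
Marked : Set
Marked = List (ℕ × Bool)

letters : Marked → List ℕ
letters = map proj₁

alt : Marked → (List ℕ → ℤ) → ℤ
alt []              φ = φ []
alt ((a , true)  ∷ w) φ = alt w (φ ∘ (a ∷_))
alt ((a , false) ∷ w) φ = alt w (φ ∘ (a ∷_)) - alt w φ

alt-congᵖ : ∀ {P : ℕ → Set} w {φ φ′} → All P (letters w) → (∀ s → All P s → φ s ≡ φ′ s) → alt w φ ≡ alt w φ′
alt-congᵖ []                []       h = h [] []
alt-congᵖ ((a , true)  ∷ w) (p ∷ ps) h = alt-congᵖ w ps (λ s q → h (a ∷ s) (p ∷ q))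
alt-congᵖ ((a , false) ∷ w) (p ∷ ps) h =
  cong₂ _-_ (alt-congᵖ w ps (λ s q → h (a ∷ s) (p ∷ q))) (alt-congᵖ w ps h)

alt-cong : ∀ w {φ φ′} → (∀ s → φ s ≡ φ′ s) → alt w φ ≡ alt w φ′
alt-cong []                h = h []
alt-cong ((a , true)  ∷ w) h = alt-cong w (h ∘ (a ∷_))
alt-cong ((a , false) ∷ w) h = cong₂ _-_ (alt-cong w (h ∘ (a ∷_))) (alt-cong w h)

alt-+ : ∀ w φ φ′ → alt w (λ s → φ s + φ′ s) ≡ alt w φ + alt w φ′
alt-+ []                φ φ′ = refl
alt-+ ((a , true)  ∷ w) φ φ′ = alt-+ w (φ ∘ (a ∷_)) (φ′ ∘ (a ∷_))
alt-+ ((a , false) ∷ w) φ φ′ =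
  trans (cong₂ _-_ (alt-+ w (φ ∘ (a ∷_)) (φ′ ∘ (a ∷_))) (alt-+ w φ φ′))
        (regroup (alt w (φ ∘ (a ∷_))) (alt w (φ′ ∘ (a ∷_))) (alt w φ) (alt w φ′))
  where
  regroup : ∀ p p′ q q′ → (p + p′) - (q + q′) ≡ (p - q) + (p′ - q′)
  regroup = solve-∀

alt-- : ∀ w φ φ′ → alt w (λ s → φ s - φ′ s) ≡ alt w φ - alt w φ′
alt-- []                φ φ′ = refl
alt-- ((a , true)  ∷ w) φ φ′ = alt-- w (φ ∘ (a ∷_)) (φ′ ∘ (a ∷_))
alt-- ((a , false) ∷ w) φ φ′ =
  trans (cong₂ _-_ (alt-- w (φ ∘ (a ∷_)) (φ′ ∘ (a ∷_))) (alt-- w φ φ′))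
        (regroup (alt w (φ ∘ (a ∷_))) (alt w (φ′ ∘ (a ∷_))) (alt w φ) (alt w φ′))
  where
  regroup : ∀ p p′ q q′ → (p - p′) - (q - q′) ≡ (p - q) - (p′ - q′)
  regroup = solve-∀

alt-const : ∀ w {c} → + 0 ≤ c → + 0 ≤ alt w (λ _ → c)
alt-const []                h = h
alt-const ((a , true)  ∷ w) h = alt-const w h
alt-const ((a , false) ∷ w) {c} h = ℤₚ.≤-reflexive (sym (ℤₚ.+-inverseʳ (alt w (λ _ → c))))

alt-++ : ∀ A B φ → alt (A ++ B) φ ≡ alt A (λ a → alt B (λ s → φ (a ++ s)))
alt-++ []                B φ = refl
alt-++ ((a , true)  ∷ A) B φ = alt-++ A B (φ ∘ (a ∷_))
alt-++ ((a , false) ∷ A) B φ = cong₂ _-_ (alt-++ A B (φ ∘ (a ∷_))) (alt-++ A B φ)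

alt-comm : ∀ A B (φ : List ℕ → List ℕ → ℤ) → alt A (λ a → alt B (φ a)) ≡ alt B (λ b → alt A (λ a → φ a b))
alt-comm []                B φ = refl
alt-comm ((a , true)  ∷ A) B φ = alt-comm A B (φ ∘ (a ∷_))
alt-comm ((a , false) ∷ A) B φ = trans (cong₂ _-_ (alt-comm A B (φ ∘ (a ∷_))) (alt-comm A B φ))
  (sym (alt-- B (λ b → alt A (λ c → φ (a ∷ c) b)) (λ b → alt A (λ c → φ c b))))

alt-K : ∀ A s (ψ : List ℕ → List ℕ → Val) μ →
  alt A (λ a → K s (ψ a) μ) ≡ K s (λ W μ → alt A (λ a → ψ a W μ)) μ
alt-K []                s ψ μ = refl
alt-K ((a , true)  ∷ A) s ψ μ = alt-K A s (ψ ∘ (a ∷_)) μ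
alt-K ((a , false) ∷ A) s ψ μ = trans (cong₂ _-_ (alt-K A s (ψ ∘ (a ∷_)) μ) (alt-K A s ψ μ))
  (sym (K-- s (λ W μ → alt A (λ c → ψ (a ∷ c) W μ)) (λ W μ → alt A (λ c → ψ c W μ)) μ))

-- B ⇝ W: W is an outcome of the column expansion of B, in which the letters that
-- are needed to define the outcome have been frozen.
-- Outcome d B c R: the same for outcomes c R that start with a letter c < d.
mutual
  data _⇝_ : Marked → Marked → Set where
    done  : [] ⇝ []
    keep  : ∀ {u B W} → B ⇝ W → (u ∷ B) ⇝ (u ∷ W)
    joinβ : ∀ {b t B c R} → Outcome b B c R → ((b , t) ∷ B) ⇝ ((b , true) ∷ (c , true) ∷ R)
    join  : ∀ {b t B c R} → Outcome b B c R → ((b , t) ∷ B) ⇝ ((c , true) ∷ (b , true) ∷ R)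

  data Outcome (d : ℕ) : Marked → ℕ → Marked → Set where
    end  : ∀ {y t B R} → y ℕ.< d → B ⇝ R → Outcome d ((y , t) ∷ B) y R
    endβ : ∀ {y t B c R} → y ℕ.< d → Outcome y B c R → Outcome d ((y , t) ∷ B) y ((c , true) ∷ R)
    -- A letter that is merely passed over is a bystander and keeps its mark.
    skip : ∀ {y t B c R} → c ℕ.< y → Outcome d B c R → Outcome d ((y , t) ∷ B) c ((y , t) ∷ R)

⇝-refl : ∀ B → B ⇝ B
⇝-refl []      = done
⇝-refl (u ∷ B) = keep (⇝-refl B)

Outcome-< : ∀ {d B c R} → Outcome d B c R → c ℕ.< d
Outcome-< (end y<d _)  = y<d
Outcome-< (endβ y<d _) = y<d
Outcome-< (skip _ o)   = Outcome-< o

Outcome-mono : ∀ {d d′ B c R} → d ℕ.≤ d′ → Outcome d B c R → Outcome d′ B c R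
Outcome-mono le (end y<d r)  = end (ℕₚ.<-≤-trans y<d le) r
Outcome-mono le (endβ y<d o) = endβ (ℕₚ.<-≤-trans y<d le) o
Outcome-mono le (skip c<y o) = skip c<y (Outcome-mono le o)

data Before (P Q : ℕ × Bool → Set) : Marked → Set where
  here  : ∀ {u w} → P u → Any Q w → Before P Q (u ∷ w)
  there : ∀ {u w} → Before P Q w → Before P Q (u ∷ w)

Is Free : ℕ → ℕ × Bool → Set
Is   a u = proj₁ u ≡ a
Free a u = u ≡ (a , false)

-- Only patterns whose 1 is free are excluded, here and below; the weak inequality makes
-- uniqueness of letters unnecessary.
Avoids312 : Marked → Set
Avoids312 B = ∀ {h x y} → Before (Is h) (Free x) B → Before (Free x) (Is y) B → x ℕ.≤ y → y ℕ.< h → ⊥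

Avoids12Below : ℕ → Marked → Set
Avoids12Below d B = ∀ {x y} → Before (Free x) (Is y) B → x ℕ.≤ y → y ℕ.< d → ⊥

Avoids1423 : Marked → Set
Avoids1423 w = ∀ {a h x y} → Before (Is a) (Is h) w → Before (Is h) (Free x) w → Before (Free x) (Is y) w →
  a ℕ.< x → x ℕ.≤ y → y ℕ.< h → ⊥

Before⇒Anyˡ : ∀ {P Q w} → Before P Q w → Any P w
Before⇒Anyˡ (here p _) = here p
Before⇒Anyˡ (there b)  = there (Before⇒Anyˡ b)

Before⇒Anyʳ : ∀ {P Q w} → Before P Q w → Any Q w
Before⇒Anyʳ (here _ q) = there q
Before⇒Anyʳ (there b)  = there (Before⇒Anyʳ b)

Avoids312-tail : ∀ {u B} → Avoids312 (u ∷ B) → Avoids312 B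
Avoids312-tail q b c = q (there b) (there c)

Avoids312-head : ∀ {b t B} → Avoids312 ((b , t) ∷ B) → Avoids12Below b B
Avoids312-head q c = q (here refl (Before⇒Anyˡ c)) (there c)

-- Positivity of the column expansion

Nonneg : Functional → Set
Nonneg μ = ∀ d → + 0 ≤ μ d

-- Coefficientwise nonnegativity: `δ k` is among the test functionals, and closure of the latter
-- under `S` takes care of factors β.
Positive : (List ℕ → Val) → Marked → Set
Positive ψ W = ∀ μ → Nonneg μ → + 0 ≤ alt W (λ s → ψ s μ)

Positive-K : ∀ B ψ → Positive ψ B → Positive (λ s μ → K s ψ μ - ψ s μ) B → Positive (λ s → K s ψ) B
Positive-K B ψ p q μ n = subst (+ 0 ≤_) (trans (sym (alt-+ B (λ s → K s ψ μ - ψ s μ) (λ s → ψ s μ)))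
    (alt-cong B (λ s → cancel (K s ψ μ) (ψ s μ)))) (ℤₚ.+-mono-≤ (q μ n) (p μ n))
  where
  cancel : ∀ a b → (a - b) + b ≡ a
  cancel = solve-∀

Positive-sum₃ : ∀ B {ψ ψ₁ ψ₂ ψ₃ : List ℕ → Val} → (∀ s μ → ψ s μ ≡ ψ₁ s μ + (ψ₂ s (S μ) + ψ₃ s μ)) →
  Positive ψ₁ B → Positive ψ₂ B → Positive ψ₃ B → Positive ψ B
Positive-sum₃ B {ψ} {ψ₁} {ψ₂} {ψ₃} e p₁ p₂ p₃ μ n = subst (+ 0 ≤_)
  (sym (trans (alt-cong B (λ s → e s μ)) (trans (alt-+ B (λ s → ψ₁ s μ) (λ s → ψ₂ s (S μ) + ψ₃ s μ))
    (cong (λ z → alt B (λ s → ψ₁ s μ) + z) (alt-+ B (λ s → ψ₂ s (S μ)) (λ s → ψ₃ s μ))))))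
  (ℤₚ.+-mono-≤ (p₁ μ n) (ℤₚ.+-mono-≤ (p₂ (S μ) (n ∘ suc)) (p₃ μ n)))

Positive-resp : ∀ B {ψ ψ′ : List ℕ → Val} → (∀ s μ → ψ s μ ≡ ψ′ s μ) → Positive ψ′ B → Positive ψ B
Positive-resp B e p μ n = subst (+ 0 ≤_) (sym (alt-cong B (λ s → e s μ))) (p μ n)

Positive-free : ∀ b W ψ → Positive ψ ((b , false) ∷ W) → Positive (λ s μ → ψ (b ∷ s) μ - ψ s μ) W
Positive-free b W ψ p μ n = subst (+ 0 ≤_) (sym (alt-- W (λ s → ψ (b ∷ s) μ) (λ s → ψ s μ))) (p μ n)

Positive-free⁻¹ : ∀ b W ψ → Positive (λ s μ → ψ (b ∷ s) μ - ψ s μ) W → Positive ψ ((b , false) ∷ W)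
Positive-free⁻¹ b W ψ p μ n = subst (+ 0 ≤_) (alt-- W (λ s → ψ (b ∷ s) μ) (λ s → ψ s μ)) (p μ n)

K-gate-lower : ∀ {y d} s χ μ → y ℕ.≤ d → All (λ c → c ℕ.< d → c ℕ.< y) s → K s (gate d χ) μ ≡ K s (gate y χ) μ
K-gate-lower {y} {d} s χ μ y≤d h = K-cong s (λ W p μ → step W (All-resp-↭ (↭-sym p) h) μ) μ
  where
  step : ∀ W → All (λ c → c ℕ.< d → c ℕ.< y) W → ∀ μ → gate d χ W μ ≡ gate y χ W μ
  step []      _       μ = refl
  step (c ∷ R) (h ∷ _) μ with c ℕ.<? d
  ... | yes c<d = trans (gate-< χ R μ c<d) (sym (gate-< χ R μ (h c<d)))
  ... | no  c≮d = trans (gate-≥ χ R μ (ℕₚ.≮⇒≥ c≮d)) (sym (gate-≥ χ R μ (ℕₚ.≤-trans y≤d (ℕₚ.≮⇒≥ c≮d))))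

mutual
  -- The subtracted `ψ s` is the outcome in which nothing moves, and this is what deleting a free
  -- minimum contributes. For free `b` the ungated sum of `K-∷` combines with the deletion of `b`
  -- into the same statement for `ψ (b ∷ W) - ψ W`. The gated sums are left without a partner, so
  -- `b` is frozen in them.
  K-positive : ∀ B ψ → Avoids312 B → (∀ {W} → B ⇝ W → Positive ψ W) → Positive (λ s μ → K s ψ μ - ψ s μ) B
  K-positive [] ψ av pos μ n = ℤₚ.≤-reflexive (sym (ℤₚ.+-inverseʳ (ψ [] μ)))
  K-positive ((b , true) ∷ B) ψ av pos = Positive-sum₃ B
    (λ s μ → trans (cong (_- ψ (b ∷ s) μ) (K-∷ b s ψ μ))
       (regroup (K s (λ W → ψ (b ∷ W)) μ) (K s (gate b (λ c R → ψ (b ∷ c ∷ R))) (S μ))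
                (K s (gate b (λ c R → ψ (c ∷ b ∷ R))) μ) (ψ (b ∷ s) μ)))
    (K-positive B (λ W → ψ (b ∷ W)) (Avoids312-tail av) (pos ∘ keep))
    (gate-positive B b (λ c R → ψ (b ∷ c ∷ R)) (Avoids312-tail av) (Avoids312-head av) (pos ∘ joinβ))
    (gate-positive B b (λ c R → ψ (c ∷ b ∷ R)) (Avoids312-tail av) (Avoids312-head av) (pos ∘ join))
    where
    regroup : ∀ p q r z → (p + (q + r)) - z ≡ (p - z) + (q + r)
    regroup = solve-∀
  K-positive ((b , false) ∷ B) ψ av pos = Positive-free⁻¹ b B (λ s μ → K s ψ μ - ψ s μ) (Positive-sum₃ B
    (λ s μ → trans (cong (λ z → (z - ψ (b ∷ s) μ) - (K s ψ μ - ψ s μ)) (K-∷ b s ψ μ))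
       (trans (regroup (K s (λ W → ψ (b ∷ W)) μ) (K s (gate b (λ c R → ψ (b ∷ c ∷ R))) (S μ))
                (K s (gate b (λ c R → ψ (c ∷ b ∷ R))) μ) (ψ (b ∷ s) μ) (K s ψ μ) (ψ s μ))
         (cong (λ z → (z - (ψ (b ∷ s) μ - ψ s μ))
                      + (K s (gate b (λ c R → ψ (b ∷ c ∷ R))) (S μ) + K s (gate b (λ c R → ψ (c ∷ b ∷ R))) μ))
               (sym (K-- s (λ W → ψ (b ∷ W)) ψ μ)))))
    (K-positive B (λ W μ → ψ (b ∷ W) μ - ψ W μ) (Avoids312-tail av)
      (λ {W} r → Positive-free b W ψ (pos (keep r))))
    (gate-positive B b (λ c R → ψ (b ∷ c ∷ R)) (Avoids312-tail av) (Avoids312-head av) (pos ∘ joinβ))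
    (gate-positive B b (λ c R → ψ (c ∷ b ∷ R)) (Avoids312-tail av) (Avoids312-head av) (pos ∘ join)))
    where
    regroup : ∀ p q r z k w → ((p + (q + r)) - z) - (k - w) ≡ ((p - k) - (z - w)) + (q + r)
    regroup = solve-∀

  -- Deleting a free `y` cancels only against the outcomes in which `y` is passed over. Those with
  -- `y` as head stay with a plus sign and freeze it. Passing over some `y < d` lowers the gate to
  -- `y`, since the head must then be smaller than `y`.
  gate-positive : ∀ B d χ → Avoids312 B → Avoids12Below d B →
    (∀ {c R} → Outcome d B c R → Positive (χ c) R) → Positive (λ s → K s (gate d χ)) B
  gate-positive [] d χ av av′ pos μ n = ℤₚ.≤-refl
  gate-positive ((y , t) ∷ B) d χ av av′ pos with y ℕ.<? d
  gate-positive ((y , true) ∷ B) d χ av av′ pos | yes y<d = Positive-sum₃ B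
    (λ s μ → K-gate-< s χ μ y<d)
    (Positive-K B (χ y) (pos (end y<d (⇝-refl B)))
      (K-positive B (χ y) (Avoids312-tail av) (λ r → pos (end y<d r))))
    (gate-positive B y (λ c R → χ y (c ∷ R)) (Avoids312-tail av) below (λ o → pos (endβ y<d o)))
    (gate-positive B y (λ c R → χ c (y ∷ R)) (Avoids312-tail av) below
      (λ o → pos (skip (Outcome-< o) (Outcome-mono (ℕₚ.<⇒≤ y<d) o))))
    where
    below : Avoids12Below y B
    below b x≤z z<y = av′ (there b) x≤z (ℕₚ.<-trans z<y y<d)
  -- As y is free, no later letter lies in [y , d), so the words without y can be gated
  -- at y as well, and cancel against those in which y is passed over.
  gate-positive ((y , false) ∷ B) d χ av av′ pos | yes y<d = λ μ n → subst (+ 0 ≤_)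
    (cong (λ z → alt B (λ s → K (y ∷ s) (gate d χ) μ) - z)
      (alt-congᵖ B (All.tabulate close) (λ s h → sym (K-gate-lower s χ μ (ℕₚ.<⇒≤ y<d) h))))
    (subst (+ 0 ≤_) (alt-- B (λ s → K (y ∷ s) (gate d χ) μ) (λ s → K s (gate y χ) μ)) (main μ n))
    where
    below : Avoids12Below y B
    below b x≤z z<y = av′ (there b) x≤z (ℕₚ.<-trans z<y y<d)
    close : ∀ {c} → _ → c ℕ.< d → c ℕ.< y
    close {c} c∈ c<d = ℕₚ.≰⇒> (λ y≤c → av′ (here refl (∈-letters B c∈)) y≤c c<d)
      where
      ∈-letters : ∀ B → Any (c ≡_) (letters B) → Any (Is c) B
      ∈-letters (u ∷ B) (here e)  = here (sym e)
      ∈-letters (u ∷ B) (there p) = there (∈-letters B p)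
    regroup : ∀ p q r z → (p + (q + r)) - z ≡ p + (q + (r - z))
    regroup = solve-∀
    main : Positive (λ s μ → K (y ∷ s) (gate d χ) μ - K s (gate y χ) μ) B
    main = Positive-sum₃ B
      (λ s μ → trans (cong (_- K s (gate y χ) μ) (K-gate-< s χ μ y<d))
        (trans (regroup (K s (χ y) μ) (K s (gate y (λ c R → χ y (c ∷ R))) (S μ))
                 (K s (gate y (λ c R → χ c (y ∷ R))) μ) (K s (gate y χ) μ))
          (cong (λ z → K s (χ y) μ + (K s (gate y (λ c R → χ y (c ∷ R))) (S μ) + z))
            (sym (K-gate-- y s (λ c R → χ c (y ∷ R)) χ μ)))))
      (Positive-K B (χ y) (pos (end y<d (⇝-refl B)))
        (K-positive B (χ y) (Avoids312-tail av) (λ r → pos (end y<d r))))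
      (gate-positive B y (λ c R → χ y (c ∷ R)) (Avoids312-tail av) below (λ o → pos (endβ y<d o)))
      (gate-positive B y (λ c R μ → χ c (y ∷ R) μ - χ c R μ) (Avoids312-tail av) below
        (λ {c} {R} o → Positive-free y R (χ c) (pos (skip (Outcome-< o) (Outcome-mono (ℕₚ.<⇒≤ y<d) o)))))
  gate-positive ((y , true) ∷ B) d χ av av′ pos | no y≮d = Positive-resp B
    (λ s μ → K-gate-≥ s χ μ (ℕₚ.≮⇒≥ y≮d))
    (gate-positive B d (λ c R → χ c (y ∷ R)) (Avoids312-tail av) (λ b → av′ (there b))
      (λ o → pos (skip (ℕₚ.<-≤-trans (Outcome-< o) (ℕₚ.≮⇒≥ y≮d)) o)))
  gate-positive ((y , false) ∷ B) d χ av av′ pos | no y≮d = Positive-free⁻¹ y B (λ s → K s (gate d χ)) (Positive-resp B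
    (λ s μ → trans (cong (_- K s (gate d χ) μ) (K-gate-≥ s χ μ (ℕₚ.≮⇒≥ y≮d)))
      (sym (K-gate-- d s (λ c R → χ c (y ∷ R)) χ μ)))
    (gate-positive B d (λ c R μ → χ c (y ∷ R) μ - χ c R μ) (Avoids312-tail av) (λ b → av′ (there b))
      (λ {c} {R} o → Positive-free y R (χ c) (pos (skip (ℕₚ.<-≤-trans (Outcome-< o) (ℕₚ.≮⇒≥ y≮d)) o)))))

-- Avoidance of 1423 is inherited

mutual
  letters-⇝ : ∀ {B W} → B ⇝ W → letters W ↭ letters B
  letters-⇝ done      = ↭-refl
  letters-⇝ (keep r)  = prep _ (letters-⇝ r)
  letters-⇝ (joinβ o) = prep _ (letters-Outcome o)
  letters-⇝ (join o)  = ↭-trans (swap _ _ ↭-refl) (prep _ (letters-Outcome o))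

  letters-Outcome : ∀ {d B c R} → Outcome d B c R → c ∷ letters R ↭ letters B
  letters-Outcome (end _ r)  = prep _ (letters-⇝ r)
  letters-Outcome (endβ _ o) = prep _ (letters-Outcome o)
  letters-Outcome (skip _ o) = ↭-trans (swap _ _ ↭-refl) (prep _ (letters-Outcome o))

-- Outcomes freeze letters but never free them, so what is seen in an outcome can be traced back if
-- it survives unfreezing. `Is a` ignores the mark, and `Free a` qualifies vacuously because it
-- never holds of a frozen letter.
record Thawable (P : ℕ × Bool → Set) : Set where
  constructor thawable
  field
    unfreeze : ∀ {a} → P (a , true) → P (a , false)

thaw : ∀ {P} → Thawable P → ∀ {a} t → P (a , true) → P (a , t)
thaw h true  p = p
thaw h false p = Thawable.unfreeze h p

mutual
  Any-⇝ : ∀ {P B W} → Thawable P → B ⇝ W → Any P W → Any P B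
  Any-⇝ h (keep r)  (here p)          = here p
  Any-⇝ h (keep r)  (there a)         = there (Any-⇝ h r a)
  Any-⇝ h (joinβ {t = t} o) (here p)  = here (thaw h t p)
  Any-⇝ h (joinβ o) (there (here p))  = there (Any-Outcome-head h o p)
  Any-⇝ h (joinβ o) (there (there a)) = there (Any-Outcome h o a)
  Any-⇝ h (join o)  (here p)          = there (Any-Outcome-head h o p)
  Any-⇝ h (join {t = t} o) (there (here p)) = here (thaw h t p)
  Any-⇝ h (join o)  (there (there a)) = there (Any-Outcome h o a)

  Any-Outcome-head : ∀ {P d B c R} → Thawable P → Outcome d B c R → P (c , true) → Any P B
  Any-Outcome-head h (end {t = t} _ _)  p = here (thaw h t p)
  Any-Outcome-head h (endβ {t = t} _ _) p = here (thaw h t p)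
  Any-Outcome-head h (skip _ o)         p = there (Any-Outcome-head h o p)

  Any-Outcome : ∀ {P d B c R} → Thawable P → Outcome d B c R → Any P R → Any P B
  Any-Outcome h (end _ r)  a         = there (Any-⇝ h r a)
  Any-Outcome h (endβ _ o) (here p)  = there (Any-Outcome-head h o p)
  Any-Outcome h (endβ _ o) (there a) = there (Any-Outcome h o a)
  Any-Outcome h (skip _ o) (here p)  = here p
  Any-Outcome h (skip _ o) (there a) = there (Any-Outcome h o a)

Any-remove : ∀ {P} → Thawable P → ∀ A {u B W} → B ⇝ W → Any P (A ++ W) → Any P (A ++ u ∷ B)
Any-remove h []      r a         = there (Any-⇝ h r a)
Any-remove h (v ∷ A) r (here p)  = here p
Any-remove h (v ∷ A) r (there a) = there (Any-remove h A r a)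

-- The only pairs that an outcome reverses are those whose smaller letter is moved to the
-- left, and that letter gets frozen.
Reversed : (P Q : ℕ × Bool → Set) → Marked → Set
Reversed P Q B = Σ ℕ λ p → Σ (ℕ × Bool) λ u → P (p , true) × Q u × p ℕ.< proj₁ u × Before Q P B

module _ {P Q : ℕ × Bool → Set} where

  later : ∀ {u B} → Before P Q B ⊎ Reversed P Q B → Before P Q (u ∷ B) ⊎ Reversed P Q (u ∷ B)
  later (inj₁ b)                           = inj₁ (there b)
  later (inj₂ (p , u , Pp , Qu , lt , b)) = inj₂ (p , u , Pp , Qu , lt , there b)

  module _ (hP : Thawable P) (hQ : Thawable Q) where
    mutual
      Before-⇝ : ∀ {B W} → B ⇝ W → Before P Q W → Before P Q B ⊎ Reversed P Q B
      Before-⇝ (keep r) (here p a) = inj₁ (here p (Any-⇝ hQ r a))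
      Before-⇝ (keep r) (there b)  = later (Before-⇝ r b)
      Before-⇝ (joinβ {t = t} o) (here p (here q))  = inj₁ (here (thaw hP t p) (Any-Outcome-head hQ o q))
      Before-⇝ (joinβ {t = t} o) (here p (there a)) = inj₁ (here (thaw hP t p) (Any-Outcome hQ o a))
      Before-⇝ (joinβ o) (there (here p a))         = later (Before-Outcome-head o p a)
      Before-⇝ (joinβ o) (there (there b))          = later (Before-Outcome o b)
      Before-⇝ (join {t = t} o) (here p (here q))   =
        inj₂ (_ , _ , p , q , Outcome-< o , here (thaw hQ t q) (Any-Outcome-head hP o p))
      Before-⇝ (join o) (here p (there a))          = later (Before-Outcome-head o p a)
      Before-⇝ (join {t = t} o) (there (here p a))  = inj₁ (here (thaw hP t p) (Any-Outcome hQ o a))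
      Before-⇝ (join o) (there (there b))           = later (Before-Outcome o b)

      Before-Outcome-head : ∀ {d B c R} → Outcome d B c R → P (c , true) → Any Q R → Before P Q B ⊎ Reversed P Q B
      Before-Outcome-head (end {t = t} _ r)  p a         = inj₁ (here (thaw hP t p) (Any-⇝ hQ r a))
      Before-Outcome-head (endβ {t = t} _ o) p (here q)  = inj₁ (here (thaw hP t p) (Any-Outcome-head hQ o q))
      Before-Outcome-head (endβ {t = t} _ o) p (there a) = inj₁ (here (thaw hP t p) (Any-Outcome hQ o a))
      Before-Outcome-head (skip c<y o) p (here q)  = inj₂ (_ , _ , p , q , c<y , here q (Any-Outcome-head hP o p))
      Before-Outcome-head (skip _ o)   p (there a) = later (Before-Outcome-head o p a)

      Before-Outcome : ∀ {d B c R} → Outcome d B c R → Before P Q R → Before P Q B ⊎ Reversed P Q B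
      Before-Outcome (end _ r)  b          = later (Before-⇝ r b)
      Before-Outcome (endβ _ o) (here p a) = later (Before-Outcome-head o p a)
      Before-Outcome (endβ _ o) (there b)  = later (Before-Outcome o b)
      Before-Outcome (skip _ o) (here p a) = inj₁ (here p (Any-Outcome hQ o a))
      Before-Outcome (skip _ o) (there b)  = later (Before-Outcome o b)

    Before-remove : ∀ A {u B W} → B ⇝ W → Before P Q (A ++ W) → Before P Q (A ++ u ∷ B) ⊎ Reversed P Q B
    Before-remove [] r b with Before-⇝ r b
    ... | inj₁ b′ = inj₁ (there b′)
    ... | inj₂ e  = inj₂ e
    Before-remove (v ∷ A) r (here p a) = inj₁ (here p (Any-remove hQ A r a))
    Before-remove (v ∷ A) r (there b)  with Before-remove A r b
    ... | inj₁ b′ = inj₁ (there b′)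
    ... | inj₂ e  = inj₂ e

Thawable-Is : ∀ {a} → Thawable (Is a)
Thawable-Is = thawable id

Thawable-Free : ∀ {a} → Thawable (Free a)
Thawable-Free = thawable λ ()

Any-All : ∀ {P : ℕ → Set} {a} w → Any (Is a) w → All P (letters w) → P a
Any-All (u ∷ w) (here refl) (p ∷ _)  = p
Any-All (u ∷ w) (there a)   (_ ∷ ps) = Any-All w a ps

Free⇒Is : ∀ {a w} → Any (Free a) w → Any (Is a) w
Free⇒Is = Any.map (cong proj₁)

Before-after : ∀ {P Q} A {u B} → P u → Any Q B → Before P Q (A ++ u ∷ B)
Before-after []      p a = here p a
Before-after (v ∷ A) p a = there (Before-after A p a)

Before-++ : ∀ {P Q} A {B} → Before P Q B → Before P Q (A ++ B)
Before-++ []      b = b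
Before-++ (v ∷ A) b = there (Before-++ A b)

-- A new 1423 pattern a h x y can only arise by moving a to the left of h; then m h x y
-- was such a pattern before.
Avoids1423-remove : ∀ A {m t B W} → All (m ℕ.<_) (letters B) → Avoids1423 (A ++ (m , t) ∷ B) → B ⇝ W →
  Avoids1423 (A ++ W)
Avoids1423-remove A {m} {t} {B} m< av r {a} {h} {x} {y} ah hx xy a<x x≤y y<h
  with Before-remove Thawable-Is Thawable-Is A {m , t} r ah
     | Before-remove Thawable-Is Thawable-Free A {m , t} r hx
     | Before-remove Thawable-Free Thawable-Is A {m , t} r xy
-- A reversed pair has its smaller letter in front and frozen. So `h` before `x` is not new, as
-- `h > x`, and `x` before `y` is not new, as `x` is free.
... | _ | inj₂ (_ , _ , refl , refl , h<x , _) | _ = ℕₚ.<-asym h<x (ℕₚ.≤-<-trans x≤y y<h)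
... | _ | inj₁ _ | inj₂ (_ , _ , () , _)
... | inj₁ ah′ | inj₁ hx′ | inj₁ xy′ = av ah′ hx′ xy′ a<x x≤y y<h
... | inj₂ (_ , _ , _ , _ , _ , ha) | inj₁ hx′ | inj₁ xy′ =
  av (Before-after A refl (Before⇒Anyˡ ha)) hx′ xy′
     (ℕₚ.<-trans (Any-All B (Before⇒Anyʳ ha) m<) a<x) x≤y y<h

-- The minimum `m`, standing before `B`, plays the 1 of the pattern.
Avoids1423⇒Avoids312 : ∀ A {m t B} → All (m ℕ.<_) (letters B) → Avoids1423 (A ++ (m , t) ∷ B) → Avoids312 B
Avoids1423⇒Avoids312 A {B = B} m< av hx xy = av (Before-after A refl (Before⇒Anyˡ hx))
  (Before-++ A (there hx)) (Before-++ A (there xy)) (Any-All B (Free⇒Is (Before⇒Anyˡ xy)) m<)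

-- Induction on the smallest letter

data Find (m : ℕ) : Marked → Set where
  found  : ∀ A t B → All (_≢ m) (letters A) → Find m (A ++ (m , t) ∷ B)
  absent : ∀ {w} → All (_≢ m) (letters w) → Find m w

find : ∀ m w → Find m w
find m [] = absent []
find m ((a , t) ∷ w) with a ℕ.≟ m
... | yes refl = found [] t w []
... | no a≢m with find m w
...   | found A t′ B A∌m = found ((a , t) ∷ A) t′ B (a≢m ∷ A∌m)
...   | absent w∌m       = absent (a≢m ∷ w∌m)

prodTo-one : ∀ n → prodTo n one ≡ + 1
prodTo-one zero    = refl
prodTo-one (suc n) = cong (_* + 1) (prodTo-one n)

g-remove-one : ∀ f m A B → All (_≢ m) A → ∀ μ →
  g (suc f) m (A ++ m ∷ B) one μ ≡ K B (λ W → g f (suc m) (A ++ W) one) μ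
g-remove-one f m A B h μ = trans (g-remove f m A B h one μ) (trans (cong (_* C) (prodTo-one (length A)))
  (trans (ℤₚ.*-identityˡ C) (col-one (suc (length A)) B (λ W → g f (suc m) (A ++ W) one) μ)))
  where
  C = col (suc (length A)) one B (λ W → g f (suc m) (A ++ W) one) μ

-- The alternating sum over `A` commutes with the expansion of `B`, so it can be moved into the test
-- function `Ψ`. Its positivity on an outcome `W` is then the induction hypothesis for `A ++ W`.
g-positive : ∀ f m w → Unique (letters w) → All (m ℕ.≤_) (letters w) → Avoids1423 w →
  Positive (λ s → g f m s one) w
g-positive zero    m w uniq m≤ av μ n = alt-const w (n 0)
g-positive (suc f) m w uniq m≤ av with find m w
... | absent w∌m = λ μ n → subst (+ 0 ≤_)
  (sym (alt-congᵖ w w∌m (λ s h → g-skip f m s h one μ)))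
  (g-positive f (suc m) w uniq (All.zipWith (λ { (m≤a , a≢m) → ℕₚ.≤∧≢⇒< m≤a (a≢m ∘ sym) }) (m≤ , w∌m)) av μ n)
... | found A t B A∌m = by-mark t av
  where
  ψ : List ℕ → List ℕ → Val
  ψ a W = g f (suc m) (a ++ W) one
  Ψ : List ℕ → Val
  Ψ W μ = alt A (λ a → ψ a W μ)
  letters≡ : ∀ W → letters (A ++ W) ≡ letters A ++ letters W
  letters≡ W = map-++ proj₁ A W
  moved : letters (A ++ (m , t) ∷ B) ↭ m ∷ letters A ++ letters B
  moved = ↭-trans (↭-reflexive (letters≡ ((m , t) ∷ B))) (shift m (letters A) (letters B))
  uniq′ : Unique (m ∷ letters A ++ letters B)
  uniq′ = Unique-resp-↭ moved uniq
  m<all : All (m ℕ.<_) (letters A ++ letters B)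
  m<all = All.zipWith (λ { (m≤a , m≢a) → ℕₚ.≤∧≢⇒< m≤a m≢a })
            (All.tail (All-resp-↭ moved m≤) , AllPairs.head uniq′)
  m<B : All (m ℕ.<_) (letters B)
  m<B = Allₚ.++⁻ʳ (letters A) m<all
  rest↭ : ∀ {W} → B ⇝ W → letters (A ++ W) ↭ letters A ++ letters B
  rest↭ {W} r = ↭-trans (↭-reflexive (letters≡ W)) (++⁺ˡ (letters A) (letters-⇝ r))
  outcomes : ∀ {t} → Avoids1423 (A ++ (m , t) ∷ B) → ∀ {W} → B ⇝ W → Positive Ψ W
  outcomes av {W} r μ n = subst (+ 0 ≤_)
    (trans (alt-++ A W (λ s → g f (suc m) s one μ)) (alt-comm A W (λ a s → ψ a s μ)))
    (g-positive f (suc m) (A ++ W) (Unique-resp-↭ (↭-sym (rest↭ r)) (AllPairs.tail uniq′))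
      (All-resp-↭ (↭-sym (rest↭ r)) m<all) (Avoids1423-remove A m<B av r) μ n)
  by-mark : ∀ t → Avoids1423 (A ++ (m , t) ∷ B) → Positive (λ s → g (suc f) m s one) (A ++ (m , t) ∷ B)
  by-mark true av μ n = subst (+ 0 ≤_) (sym (begin
      alt (A ++ (m , true) ∷ B) F                       ≡⟨ alt-++ A ((m , true) ∷ B) F ⟩
      alt A (λ a → alt B (λ s → F (a ++ m ∷ s)))
        ≡⟨ alt-congᵖ A A∌m (λ a h → alt-cong B (λ s → g-remove-one f m a s h μ)) ⟩
      alt A (λ a → alt B (λ s → K s (ψ a) μ))           ≡⟨ alt-comm A B (λ a s → K s (ψ a) μ) ⟩
      alt B (λ s → alt A (λ a → K s (ψ a) μ))           ≡⟨ alt-cong B (λ s → alt-K A s ψ μ) ⟩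
      alt B (λ s → K s Ψ μ) ∎))
    (Positive-K B Ψ (outcomes av (⇝-refl B))
      (K-positive B Ψ (Avoids1423⇒Avoids312 A m<B av) (outcomes av)) μ n)
    where
    open ≡-Reasoning
    F : List ℕ → ℤ
    F s = g (suc f) m s one μ
  -- Deleting the free `m` leaves `a ++ s` with value `ψ a s`, the trivial outcome, which is the
  -- term that `K-positive` subtracts. A frozen `m` is never deleted, and there `Positive-K` adds
  -- this term back.
  by-mark false av μ n = subst (+ 0 ≤_) (sym (begin
      alt (A ++ (m , false) ∷ B) F                      ≡⟨ alt-++ A ((m , false) ∷ B) F ⟩
      alt A (λ a → alt B (λ s → F (a ++ m ∷ s)) - alt B (λ s → F (a ++ s)))
        ≡⟨ alt-congᵖ A A∌m (λ a h → cong₂ _-_ (alt-cong B (λ s → g-remove-one f m a s h μ))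
             (alt-congᵖ B (All.map (λ m<b e → ℕₚ.<-irrefl (sym e) m<b) m<B)
               (λ s h′ → g-skip f m (a ++ s) (Allₚ.++⁺ h h′) one μ))) ⟩
      alt A (λ a → alt B (λ s → K s (ψ a) μ) - alt B (λ s → ψ a s μ))
        ≡⟨ alt-- A (λ a → alt B (λ s → K s (ψ a) μ)) (λ a → alt B (λ s → ψ a s μ)) ⟩
      alt A (λ a → alt B (λ s → K s (ψ a) μ)) - alt A (λ a → alt B (λ s → ψ a s μ))
        ≡⟨ cong₂ _-_ (trans (alt-comm A B (λ a s → K s (ψ a) μ)) (alt-cong B (λ s → alt-K A s ψ μ)))
                     (alt-comm A B (λ a s → ψ a s μ)) ⟩
      alt B (λ s → K s Ψ μ) - alt B (λ s → Ψ s μ)       ≡⟨ alt-- B (λ s → K s Ψ μ) (λ s → Ψ s μ) ⟨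
      alt B (λ s → K s Ψ μ - Ψ s μ) ∎))
    (K-positive B Ψ (Avoids1423⇒Avoids312 A m<B av) (outcomes av) μ n)
    where
    open ≡-Reasoning
    F : List ℕ → ℤ
    F s = g (suc f) m s one μ

-- From the definition of c_w to alternating sums over marked words

free : List ℕ → Marked
free = map (_, false)

letters-free : ∀ w → letters (free w) ≡ w
letters-free []      = refl
letters-free (a ∷ w) = cong (a ∷_) (letters-free w)

Σ-cong : ∀ {X : Set} {P : X → Set} {f h : X → ℤ} xs → All P xs → (∀ x → P x → f x ≡ h x) →
  sumℤ (map f xs) ≡ sumℤ (map h xs)
Σ-cong []       []       e = refl
Σ-cong (x ∷ xs) (p ∷ ps) e = cong₂ _+_ (e x p) (Σ-cong xs ps e)

Σ-++ : ∀ {X : Set} (f : X → ℤ) xs ys → sumℤ (map f (xs ++ ys)) ≡ sumℤ (map f xs) + sumℤ (map f ys)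
Σ-++ f []       ys = sym (ℤₚ.+-identityˡ _)
Σ-++ f (x ∷ xs) ys = trans (cong (λ z → f x + z) (Σ-++ f xs ys)) (sym (ℤₚ.+-assoc (f x) _ _))

Σ-map : ∀ {X Y : Set} (f : Y → ℤ) (h : X → Y) xs → sumℤ (map f (map h xs)) ≡ sumℤ (map (f ∘ h) xs)
Σ-map f h []       = refl
Σ-map f h (x ∷ xs) = cong (λ z → f (h x) + z) (Σ-map f h xs)

Σ-neg : ∀ {X : Set} (f : X → ℤ) xs → sumℤ (map (λ x → - f x) xs) ≡ - sumℤ (map f xs)
Σ-neg f []       = refl
Σ-neg f (x ∷ xs) = trans (cong (λ z → - f x + z) (Σ-neg f xs)) (sym (ℤₚ.neg-distrib-+ (f x) _))

subwords-length : ∀ w → All (λ v → length v ℕ.≤ length w) (subwords w)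
subwords-length []      = z≤n ∷ []
subwords-length (a ∷ w) = Allₚ.++⁺ (Allₚ.map⁺ (All.map s≤s (subwords-length w)))
                                  (All.map ℕₚ.m≤n⇒m≤1+n (subwords-length w))

alternating-sum : ∀ w φ →
  sumℤ (map (λ v → signPow (length w ∸ length v) * φ v) (subwords w)) ≡ alt (free w) φ
alternating-sum []      φ = trans (ℤₚ.+-identityʳ _) (ℤₚ.*-identityˡ (φ []))
alternating-sum (a ∷ w) φ = begin
  sumℤ (map F (map (a ∷_) (subwords w) ++ subwords w))
    ≡⟨ Σ-++ F (map (a ∷_) (subwords w)) (subwords w) ⟩
  sumℤ (map F (map (a ∷_) (subwords w))) + sumℤ (map F (subwords w))
    ≡⟨ cong₂ _+_ (trans (Σ-map F (a ∷_) (subwords w)) (alternating-sum w (φ ∘ (a ∷_))))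
         -- Subtraction is truncated, so deleting `a` flips the sign only because a subword is no
         -- longer than `w`.
         (trans (Σ-cong (subwords w) (subwords-length w) (λ v l →
                   trans (cong (λ n → signPow n * φ v) (ℕₚ.+-∸-assoc 1 l))
                         (sym (ℤₚ.neg-distribˡ-* (signPow (length w ∸ length v)) (φ v)))))
           (trans (Σ-neg _ (subwords w)) (cong -_ (alternating-sum w φ)))) ⟩
  alt (free w) (φ ∘ (a ∷_)) - alt (free w) φ ∎
  where
  open ≡-Reasoning
  F : List ℕ → ℤ
  F v = signPow (suc (length w) ∸ length v) * φ v

subwords-All : ∀ {P : ℕ → Set} w → All P w → All (All P) (subwords w)
subwords-All []      []       = [] ∷ []
subwords-All (a ∷ w) (p ∷ ps) =
  Allₚ.++⁺ (Allₚ.map⁺ (All.map (p ∷_) (subwords-All w ps))) (subwords-All w ps)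

subwords-Unique : ∀ w → Unique w → All Unique (subwords w)
subwords-Unique []      []       = [] ∷ []
subwords-Unique (a ∷ w) (p ∷ ps) =
  Allₚ.++⁺ (Allₚ.map⁺ (All.zipWith (λ { (q , u) → q ∷ u }) (subwords-All w p , subwords-Unique w ps)))
           (subwords-Unique w ps)

subwords-Valid : ∀ {f m} w → Valid f m w → All (Valid f m) (subwords w)
subwords-Valid w (valid u b) =
  All.zipWith (λ { (u , b) → valid u b }) (subwords-Unique w u , subwords-All w b)

cCoeff-alt : ∀ F m w → Valid F m w → ∀ k → cCoeff w k ≡ alt (free w) (λ s → g F m s one (δ k))
cCoeff-alt F m w V k = trans
  (Σ-cong (subwords w) (subwords-Valid w V)
    (λ v V′ → cong (signPow (length w ∸ length v) *_) (upsilonCoeff-stdz F m v V′ k)))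
  (alternating-sum w (λ s → g F m s one (δ k)))

-- Occurrences of 1423 as subwords

∉-free : ∀ {c a w} → All (c ≢_) w → Any (Is a) (free w) → c ≢ a
∉-free {w = b ∷ w} (c≢b ∷ _) (here refl) = c≢b
∉-free {w = b ∷ w} (_ ∷ ps)  (there p)   = ∉-free ps p

∈-subwords₁ : ∀ {y} w → Any (Is y) (free w) → (y ∷ []) ∈ subwords w
∈-subwords₁ (c ∷ w) (here refl) = ∈-++⁺ˡ (∈-map⁺ (c ∷_) (nil w))
  where
  nil : ∀ w → [] ∈ subwords w
  nil []      = here refl
  nil (c ∷ w) = ∈-++⁺ʳ (map (c ∷_) (subwords w)) (nil w)
∈-subwords₁ (c ∷ w) (there p) = ∈-++⁺ʳ (map (c ∷_) (subwords w)) (∈-subwords₁ w p)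

∈-subwords₂ : ∀ {x y} w → Before (Free x) (Is y) (free w) → (x ∷ y ∷ []) ∈ subwords w
∈-subwords₂ (c ∷ w) (here refl p) = ∈-++⁺ˡ (∈-map⁺ (c ∷_) (∈-subwords₁ w p))
∈-subwords₂ (c ∷ w) (there b)     = ∈-++⁺ʳ (map (c ∷_) (subwords w)) (∈-subwords₂ w b)

-- `Before` speaks of letters, not positions. Uniqueness identifies the two occurrences of `x`, so
-- that the pairs can be chained.
∈-subwords₃ : ∀ {h x y} w → Unique w → h ≢ x → Before (Is h) (Free x) (free w) →
  Before (Free x) (Is y) (free w) → (h ∷ x ∷ y ∷ []) ∈ subwords w
∈-subwords₃ (c ∷ w) _ h≢x (here refl _) (here refl _) = ⊥-elim (h≢x refl)
∈-subwords₃ (c ∷ w) _ h≢x (here refl _) (there b)     = ∈-++⁺ˡ (∈-map⁺ (c ∷_) (∈-subwords₂ w b))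
∈-subwords₃ (c ∷ w) (c∉ ∷ _) h≢x (there b) (here refl _) =
  ⊥-elim (∉-free c∉ (Free⇒Is (Before⇒Anyʳ b)) refl)
∈-subwords₃ (c ∷ w) (_ ∷ u) h≢x (there b) (there b′) =
  ∈-++⁺ʳ (map (c ∷_) (subwords w)) (∈-subwords₃ w u h≢x b b′)

∈-subwords₄ : ∀ {a h x y} w → Unique w → a ≢ h → a ≢ x → h ≢ x → Before (Is a) (Is h) (free w) →
  Before (Is h) (Free x) (free w) → Before (Free x) (Is y) (free w) → (a ∷ h ∷ x ∷ y ∷ []) ∈ subwords w
∈-subwords₄ (c ∷ w) _ a≢h a≢x h≢x (here refl _) (here refl _) _ = ⊥-elim (a≢h refl)
∈-subwords₄ (c ∷ w) _ a≢h a≢x h≢x (here refl _) (there _) (here refl _) = ⊥-elim (a≢x refl)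
∈-subwords₄ (c ∷ w) (_ ∷ u) a≢h a≢x h≢x (here refl _) (there b) (there b′) =
  ∈-++⁺ˡ (∈-map⁺ (c ∷_) (∈-subwords₃ w u h≢x b b′))
∈-subwords₄ (c ∷ w) (c∉ ∷ _) a≢h a≢x h≢x (there b) (here refl _) _ =
  ⊥-elim (∉-free c∉ (Before⇒Anyʳ b) refl)
∈-subwords₄ (c ∷ w) (c∉ ∷ _) a≢h a≢x h≢x (there _) (there b) (here refl _) =
  ⊥-elim (∉-free c∉ (Free⇒Is (Before⇒Anyʳ b)) refl)
∈-subwords₄ (c ∷ w) (_ ∷ u) a≢h a≢x h≢x (there b) (there b′) (there b″) =
  ∈-++⁺ʳ (map (c ∷_) (subwords w)) (∈-subwords₄ w u a≢h a≢x h≢x b b′ b″)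

stdz-1423 : ∀ {a h x y} → a ℕ.< x → x ℕ.< y → y ℕ.< h → stdz (a ∷ h ∷ x ∷ y ∷ []) ≡ 1 ∷ 4 ∷ 2 ∷ 3 ∷ []
stdz-1423 {a} {h} {x} {y} a<x x<y y<h
  rewrite <ᵇ-false (ℕₚ.≤-refl {a}) | <ᵇ-false (ℕₚ.≤-refl {h}) | <ᵇ-false (ℕₚ.≤-refl {x}) | <ᵇ-false (ℕₚ.≤-refl {y})
        | <ᵇ-true a<x | <ᵇ-true x<y | <ᵇ-true y<h
        | <ᵇ-true (ℕₚ.<-trans a<x x<y) | <ᵇ-true (ℕₚ.<-trans x<y y<h) | <ᵇ-true (ℕₚ.<-trans a<x (ℕₚ.<-trans x<y y<h))
        | <ᵇ-false (ℕₚ.<⇒≤ a<x) | <ᵇ-false (ℕₚ.<⇒≤ x<y) | <ᵇ-false (ℕₚ.<⇒≤ y<h)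
        | <ᵇ-false (ℕₚ.<⇒≤ (ℕₚ.<-trans a<x x<y)) | <ᵇ-false (ℕₚ.<⇒≤ (ℕₚ.<-trans x<y y<h))
        | <ᵇ-false (ℕₚ.<⇒≤ (ℕₚ.<-trans a<x (ℕₚ.<-trans x<y y<h))) = refl

patternCount≡0 : ∀ u {v} w → patternCount u w ≡ 0 → v ∈ subwords w → stdz v ≢ u
patternCount≡0 u w zero-count v∈ e =
  empty (filter (λ v → ≡-dec ℕ._≟_ (stdz v) u) (subwords w)) zero-count
        (∈-filter⁺ (λ v → ≡-dec ℕ._≟_ (stdz v) u) v∈ e)
  where
  empty : ∀ (xs : List (List ℕ)) {v} → length xs ≡ 0 → v ∈ xs → ⊥
  empty [] _ ()

Avoids1423-free : ∀ w → Unique w → patternCount (1 ∷ 4 ∷ 2 ∷ 3 ∷ []) w ≡ 0 → Avoids1423 (free w)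
Avoids1423-free w u zero-count {a} {h} {x} {y} ah hx xy a<x x≤y y<h = patternCount≡0 _ w zero-count
  (∈-subwords₄ w u (ℕₚ.<⇒≢ (ℕₚ.<-trans a<x x<h)) (ℕₚ.<⇒≢ a<x) (ℕₚ.>⇒≢ x<h) ah hx xy)
  (stdz-1423 a<x (ℕₚ.≤∧≢⇒< x≤y (x≢y w u xy)) y<h)
  where
  x<h : x ℕ.< h
  x<h = ℕₚ.≤-<-trans x≤y y<h
  x≢y : ∀ w → Unique w → Before (Free x) (Is y) (free w) → x ≢ y
  x≢y (c ∷ w) (c∉ ∷ _) (here refl p) = ∉-free c∉ p
  x≢y (c ∷ w) (_ ∷ u)  (there b)     = x≢y w u b

IsPerm⇒Valid : ∀ w → IsPerm w → Valid (suc (length w)) 0 w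
IsPerm⇒Valid w p = Valid-resp-↭ (↭-sym p) (valid (Uniqueₚ.map⁺ ℕₚ.suc-injective (Uniqueₚ.upTo⁺ (length w)))
  (Allₚ.map⁺ (Allₚ.applyUpTo⁺₁ id (length w) (λ i<n → z≤n , s≤s i<n))))

theorem1p4 : (w : List ℕ) → IsPerm w → patternCount (1 ∷ 4 ∷ 2 ∷ 3 ∷ []) w ≡ 0 →
    (k : ℕ) → + 0 ≤ cCoeff w k
theorem1p4 w perm zero-count k = subst (+ 0 ≤_) (sym (cCoeff-alt F 0 w V k))
  (g-positive F 0 (free w) (subst Unique (sym (letters-free w)) (Valid.unique V))
    (All.tabulate (λ _ → z≤n)) (Avoids1423-free w (Valid.unique V) zero-count) (δ k) δ-nonneg)
  where
  -- The letters 1, ..., n lie in the range [0, n + 1) that starts at 0; the absent value 0 costs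
  -- one unit of fuel.
  F = suc (length w)
  V = IsPerm⇒Valid w perm
  δ-nonneg : Nonneg (δ k)
  δ-nonneg d with d ℕ.≡ᵇ k
  ... | true  = +≤+ z≤n
  ... | false = ℤₚ.≤-refl
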